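{- Let $G=(V,E,s)$ be an undirected graph with source $s$, with $n$ vertices and $m$ edges. A LexUP ordering of $G$ can be computed in linear time, i.e. in time $O(n+m)$.
   Context: A (undirected) graph with a source is a triple $(V,E,s)$ where $V$ is a finite set (of vertices), $E$ is a set of two-element subsets of $V$ (edges), and $s\in V$. The neighborhood of $v$ is $N(v)=\{w\mid\{v,w\}\in E\}$. Lexicographic order on words: $\mathbf a=a_1\dots a_p$ is smaller than $\mathbf b=b_1\dots b_q$ if there is $0\le i\le\min(p,q)$ such that $a_j=b_j$ for all $1\le j\le i$ and either $i=p<q$ or ($i<\min(p,q)$ and $a_{i+1}<b_{i+1}$). The symbol $\infty$ is larger than every integer. LexUP is the following (nondeterministic) search procedure on $G=(V,E,s)$ with $n=|V|$. Every vertex carries a label, which is a word; initially the label of every vertex is the empty word, except the label of $s$, which is the one-letter word $\infty$. All vertices are initially unnumbered. For $i=1,\dots,n$: choose an unnumbered vertex $v$ whose label is lexicographically maximal among the labels of unnumbered vertices (ties broken arbitrarily); set $\sigma[i]:=v$ (so $v$ becomes numbered); then for every unnumbered $w\in N(v)$, append $i$ to the label of $w$ (i.e. add it at the end). The output is $\sigma$. A LexUP ordering of $G$ is any possible output $\sigma$ of this procedure on $G$. Computation model: vertices are $v_1,\dots,v_n$, and the graph is given as an array of size $n$ whose $i$-th entry is the (doubly linked) list of neighbors of $v_i$. Integers of absolute value at most $\max(|V|,2|E|)$ can be assigned, incremented and compared in constant time. Arrays are created in time linear in their size, with constant-time read and write of entries. Doubly linked lists support constant-time access to the first and last node, insertion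 at either end, access to the predecessor, successor and value of a node, insertion before or after a given node, and removal of a given node. -}

module Defs where

open import Data.Bool using (Bool; true; false; T; if_then_else_; _∧_; not)
open import Data.Fin using (Fin; toℕ; fromℕ<)
import Data.Fin as Fin
open import Data.Integer using (ℤ; +_; ∣_∣)
import Data.Integer as ℤ
open import Data.List using (List; []; _∷_; [_]; _++_; length; zip; upTo; reverse; allFin; cartesianProduct; filter)
import Data.List as List
open import Data.List.Membership.Propositional using (_∈_)
open import Data.List.Relation.Binary.Lex.Strict using (Lex-<)
open import Data.List.Relation.Unary.Unique.Propositional using (Unique)
open import Data.Maybe using (Maybe; just; nothing)
open import Data.Nat using (ℕ; zero; suc; _+_; _*_; _⊔_; _≤_; _<_; _≡ᵇ_; _<?_)
open import Data.Product using (_×_; _,_; ∃-syntax)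
open import Data.Vec using (Vec; _∷ʳ_; lookup)
import Data.Vec as Vec
open import Data.Vec.Membership.Propositional using () renaming (_∉_ to _∉ᵛ_)
import Data.Vec.Membership.DecPropositional as VecDec
open import Function using (_⇔_)
open import Relation.Binary.Construct.Add.Supremum.Strict (_<_) using (_<⁺_)
open import Relation.Binary.PropositionalEquality using (_≡_)
open import Relation.Nullary using (¬_; yes; no; does)
open import Relation.Nullary.Decidable using (T?; _×-dec_)
open import Relation.Nullary.Construct.Add.Supremum using (_⁺; ⊤⁺) renaming ([_] to int⁺)

-- The vertex v_i is the element of Fin ∣V∣ whose toℕ is i − 1.  The set of
-- two-element subsets E is given by its characteristic function on pairs.
record Graph : Set where
  field
    ∣V∣        : ℕ
    adjacent   : Fin ∣V∣ → Fin ∣V∣ → Bool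
    symmetric  : ∀ v w → adjacent v w ≡ adjacent w v
    loopless   : ∀ v → adjacent v v ≡ false
    source     : Fin ∣V∣

  Vertex : Set
  Vertex = Fin ∣V∣

  -- Each edge {v , w} is listed once, as the pair with v < w.
  edges : List (Vertex × Vertex)
  edges = filter (λ (v , w) → (v Fin.<? w) ×-dec T? (adjacent v w))
                 (cartesianProduct (allFin ∣V∣) (allFin ∣V∣))

  ∣E∣ : ℕ
  ∣E∣ = length edges

Letter : Set
Letter = ℕ ⁺

Word : Set
Word = List Letter

infix 4 _<ˡᵉˣ_

_<ˡᵉˣ_ : Word → Word → Set
_<ˡᵉˣ_ = Lex-< _≡_ _<⁺_

module LexUP (G : Graph) where
  open Graph G

  Labelling : Set
  Labelling = Vertex → Word

  initialLabels : Labelling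
  initialLabels v = if does (v Fin.≟ source) then [ ⊤⁺ ] else []

  -- σ contains the numbered vertices, v included.
  appendToNeighbours : ∀ {k} → ℕ → Vec Vertex k → Vertex → Labelling → Labelling
  appendToNeighbours i σ v label w =
    if adjacent v w ∧ not (does (w ∈? σ)) then label w ++ [ int⁺ i ] else label w
    where open VecDec Fin._≟_ using (_∈?_)

  -- Run i σ label: the procedure may have chosen σ[1], …, σ[i] after i
  -- iterations and then have the labels given by label.
  data Run : (i : ℕ) → Vec Vertex i → Labelling → Set where
    start  : Run 0 Vec.[] initialLabels
    choose : ∀ {i σ label} (v : Vertex) →
             Run i σ label →
             v ∉ᵛ σ →
             (∀ w → w ∉ᵛ σ → ¬ (label v <ˡᵉˣ label w)) →
             Run (suc i) (σ ∷ʳ v)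
                 (appendToNeighbours (suc i) (σ ∷ʳ v) v label)

  IsLexUPOrdering : Vec Vertex ∣V∣ → Set
  IsLexUPOrdering σ = ∃[ label ] Run ∣V∣ σ label

open LexUP public using (IsLexUPOrdering)

-- A node reference names the list containing the node and the identifier of
-- the node within that list.
data Value : Set where
  nil      : Value
  int      : ℤ → Value
  arrayRef : (address : ℕ) → Value
  listRef  : (address : ℕ) → Value
  nodeRef  : (address node : ℕ) → Value

Node : Set
Node = ℕ × Value

-- The entries of an array of size k are those at the indices 1, …, k; its
-- contents elsewhere are inaccessible.  In dlist k xs the node identifiers in
-- xs are pairwise distinct and k exceeds all of them: this holds in the input
-- and every command below preserves it.
data Object : Set where
  array : (size : ℕ) (contents : ℕ → Value) → Object
  dlist : (fresh : ℕ) (nodes : List Node) → Object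

Register : Set
Register = ℕ

record State : Set where
  constructor ⟨_,_,_⟩
  field
    registers : Register → Value
    heap      : ℕ → Maybe Object
    nextFree  : ℕ

open State public

infixl 9 _[_↦_]

_[_↦_] : {A : Set} → (ℕ → A) → ℕ → A → (ℕ → A)
(f [ k ↦ a ]) j = if j ≡ᵇ k then a else f j

setRegister : Register → Value → State → State
setRegister x v ⟨ r , h , a ⟩ = ⟨ r [ x ↦ v ] , h , a ⟩

store : ℕ → Object → State → State
store b o ⟨ r , h , a ⟩ = ⟨ r , h [ b ↦ just o ] , a ⟩

allocate : Object → State → State
allocate o ⟨ r , h , a ⟩ = ⟨ r , h [ a ↦ just o ] , suc a ⟩

headRef : ℕ → List Node → Value
headRef b []            = nil
headRef b ((j , _) ∷ _) = nodeRef b j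

infix  6 _lessThan_ _equals_ _:=const_ _:=_ _:=_⟨_⟩ _⟨_⟩:=_
infixr 4 _⨾_

data Test : Set where
  _lessThan_ : Register → Register → Test
  _equals_   : Register → Register → Test
  isNil      : Register → Test

data Command : Set where
  _:=const_      : (x : Register) (i : ℤ) → Command
  :=nil          : (x : Register) → Command
  _:=_           : (x y : Register) → Command
  increment      : (x : Register) → Command
  newArray       : (x size init : Register) → Command
  _:=_⟨_⟩        : (x a i : Register) → Command
  _⟨_⟩:=_        : (a i y : Register) → Command
  newList        : (x : Register) → Command
  firstOf lastOf : (x l : Register) → Command
  insertFirst    : (l y : Register) → Command
  insertLast     : (l y : Register) → Command
  predecessor    : (x p : Register) → Command
  successor      : (x p : Register) → Command
  valueOf        : (x p : Register) → Command
  insertBefore   : (p y : Register) → Command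
  insertAfter    : (p y : Register) → Command
  removeNode     : (p : Register) → Command
  skip           : Command
  _⨾_            : Command → Command → Command
  ifThenElse     : Test → Command → Command → Command
  while          : Test → Command → Command

evaluate : Test → (Register → Value) → Maybe Bool
evaluate (x lessThan y) r with r x | r y
... | int i | int j = just (does (i ℤ.<? j))
... | _     | _     = nothing
evaluate (x equals y) r with r x | r y
... | int i | int j = just (does (i ℤ.≟ j))
... | _     | _     = nothing
evaluate (isNil x) r with r x
... | nil = just true
... | _   = just false

-- B ⊢ c , s ⇓[ t ] s′: when integers are limited to absolute value at most B,
-- the command c started in s terminates in s′ in time t.  A command that none
-- of the rules applies to (integer too large, index out of range, node no
-- longer in its list, …) has no terminating execution.  Since node
-- identifiers in a list are distinct, the splittings ys ++ (j , v) ∷ zs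
-- below are unique and execution is deterministic.
infix 3 _⊢_,_⇓[_]_

data _⊢_,_⇓[_]_ (B : ℕ) : Command → State → ℕ → State → Set where

  const⇓ : ∀ {x i s} →
    ∣ i ∣ ≤ B →
    B ⊢ x :=const i , s ⇓[ 1 ] setRegister x (int i) s

  nil⇓ : ∀ {x s} →
    B ⊢ :=nil x , s ⇓[ 1 ] setRegister x nil s

  assign⇓ : ∀ {x y s} →
    B ⊢ x := y , s ⇓[ 1 ] setRegister x (registers s y) s

  increment⇓ : ∀ {x i s} →
    registers s x ≡ int i → ∣ ℤ.suc i ∣ ≤ B →
    B ⊢ increment x , s ⇓[ 1 ] setRegister x (int (ℤ.suc i)) s

  newArray⇓ : ∀ {x y z k s} →
    registers s y ≡ int (+ k) →
    B ⊢ newArray x y z , s ⇓[ suc k ]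
      setRegister x (arrayRef (nextFree s)) (allocate (array k (λ _ → registers s z)) s)

  read⇓ : ∀ {x a i b k f j s} →
    registers s a ≡ arrayRef b → heap s b ≡ just (array k f) →
    registers s i ≡ int (+ j) → 1 ≤ j → j ≤ k →
    B ⊢ x := a ⟨ i ⟩ , s ⇓[ 1 ] setRegister x (f j) s

  write⇓ : ∀ {a i y b k f j s} →
    registers s a ≡ arrayRef b → heap s b ≡ just (array k f) →
    registers s i ≡ int (+ j) → 1 ≤ j → j ≤ k →
    B ⊢ a ⟨ i ⟩:= y , s ⇓[ 1 ] store b (array k (f [ j ↦ registers s y ])) s

  newList⇓ : ∀ {x s} →
    B ⊢ newList x , s ⇓[ 1 ]
      setRegister x (listRef (nextFree s)) (allocate (dlist 0 []) s)

  firstOf⇓ : ∀ {x l b k xs s} →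
    registers s l ≡ listRef b → heap s b ≡ just (dlist k xs) →
    B ⊢ firstOf x l , s ⇓[ 1 ] setRegister x (headRef b xs) s

  lastOf⇓ : ∀ {x l b k xs s} →
    registers s l ≡ listRef b → heap s b ≡ just (dlist k xs) →
    B ⊢ lastOf x l , s ⇓[ 1 ] setRegister x (headRef b (reverse xs)) s

  insertFirst⇓ : ∀ {l y b k xs s} →
    registers s l ≡ listRef b → heap s b ≡ just (dlist k xs) →
    B ⊢ insertFirst l y , s ⇓[ 1 ]
      store b (dlist (suc k) ((k , registers s y) ∷ xs)) s

  insertLast⇓ : ∀ {l y b k xs s} →
    registers s l ≡ listRef b → heap s b ≡ just (dlist k xs) →
    B ⊢ insertLast l y , s ⇓[ 1 ]
      store b (dlist (suc k) (xs ++ [ (k , registers s y) ])) s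

  predecessor⇓ : ∀ {x p b k ys j v zs s} →
    registers s p ≡ nodeRef b j → heap s b ≡ just (dlist k (ys ++ (j , v) ∷ zs)) →
    B ⊢ predecessor x p , s ⇓[ 1 ] setRegister x (headRef b (reverse ys)) s

  successor⇓ : ∀ {x p b k ys j v zs s} →
    registers s p ≡ nodeRef b j → heap s b ≡ just (dlist k (ys ++ (j , v) ∷ zs)) →
    B ⊢ successor x p , s ⇓[ 1 ] setRegister x (headRef b zs) s

  valueOf⇓ : ∀ {x p b k ys j v zs s} →
    registers s p ≡ nodeRef b j → heap s b ≡ just (dlist k (ys ++ (j , v) ∷ zs)) →
    B ⊢ valueOf x p , s ⇓[ 1 ] setRegister x v s

  insertBefore⇓ : ∀ {p y b k ys j v zs s} →
    registers s p ≡ nodeRef b j → heap s b ≡ just (dlist k (ys ++ (j , v) ∷ zs)) →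
    B ⊢ insertBefore p y , s ⇓[ 1 ]
      store b (dlist (suc k) (ys ++ (k , registers s y) ∷ (j , v) ∷ zs)) s

  insertAfter⇓ : ∀ {p y b k ys j v zs s} →
    registers s p ≡ nodeRef b j → heap s b ≡ just (dlist k (ys ++ (j , v) ∷ zs)) →
    B ⊢ insertAfter p y , s ⇓[ 1 ]
      store b (dlist (suc k) (ys ++ (j , v) ∷ (k , registers s y) ∷ zs)) s

  removeNode⇓ : ∀ {p b k ys j v zs s} →
    registers s p ≡ nodeRef b j → heap s b ≡ just (dlist k (ys ++ (j , v) ∷ zs)) →
    B ⊢ removeNode p , s ⇓[ 1 ] store b (dlist k (ys ++ zs)) s

  skip⇓ : ∀ {s} →
    B ⊢ skip , s ⇓[ 1 ] s

  seq⇓ : ∀ {c d s s′ s″ t u} →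
    B ⊢ c , s ⇓[ t ] s′ → B ⊢ d , s′ ⇓[ u ] s″ →
    B ⊢ c ⨾ d , s ⇓[ t + u ] s″

  ifTrue⇓ : ∀ {b c d s s′ t} →
    evaluate b (registers s) ≡ just true → B ⊢ c , s ⇓[ t ] s′ →
    B ⊢ ifThenElse b c d , s ⇓[ suc t ] s′

  ifFalse⇓ : ∀ {b c d s s′ t} →
    evaluate b (registers s) ≡ just false → B ⊢ d , s ⇓[ t ] s′ →
    B ⊢ ifThenElse b c d , s ⇓[ suc t ] s′

  whileTrue⇓ : ∀ {b c s s′ s″ t u} →
    evaluate b (registers s) ≡ just true →
    B ⊢ c , s ⇓[ t ] s′ → B ⊢ while b c , s′ ⇓[ u ] s″ →
    B ⊢ while b c , s ⇓[ suc (t + u) ] s″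

  whileFalse⇓ : ∀ {b c s} →
    evaluate b (registers s) ≡ just false →
    B ⊢ while b c , s ⇓[ 1 ] s

-- The order in which each list presents the neighbours is arbitrary.
record AdjacencyLists (G : Graph) : Set where
  open Graph G
  field
    neighbours : Vertex → List Vertex
    unique     : ∀ v → Unique (neighbours v)
    complete   : ∀ v w → w ∈ neighbours v ⇔ adjacent v w ≡ true

vertexValue : ∀ {n} → Fin n → Value
vertexValue v = int (+ suc (toℕ v))

module _ {G : Graph} (A : AdjacencyLists G) where
  open Graph G
  open AdjacencyLists A

  neighbourList : Vertex → Object
  neighbourList v =
    dlist (length ws) (zip (upTo (length ws)) (List.map vertexValue ws))
    where ws = neighbours v

  -- Register 0 holds the array of neighbour lists, which is at address 0 and
  -- whose i-th entry refers to the list at address i.  Register 1 holds the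
  -- number of vertices and register 2 the source.
  input : State
  input = ⟨ inputRegisters , inputHeap , suc ∣V∣ ⟩
    where
    inputRegisters : Register → Value
    inputRegisters 0 = arrayRef 0
    inputRegisters 1 = int (+ ∣V∣)
    inputRegisters 2 = vertexValue source
    inputRegisters _ = nil

    inputHeap : ℕ → Maybe Object
    inputHeap zero    = just (array ∣V∣ listRef)
    inputHeap (suc i) with i <? ∣V∣
    ... | yes i<n = just (neighbourList (fromℕ< i<n))
    ... | no  _   = nothing

-- The output is the array σ[1], …, σ[n], referred to by register 0.
Outputs : ∀ {n} → State → Vec (Fin n) n → Set
Outputs {n} s σ =
  ∃[ b ] ∃[ f ] (registers s 0 ≡ arrayRef b
               × heap s b ≡ just (array n f)
               × (∀ (i : Fin n) → f (suc (toℕ i)) ≡ vertexValue (lookup σ i)))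

integerBound : Graph → ℕ
integerBound G = ∣V∣ ⊔ 2 * ∣E∣
  where open Graph G

{-# OPTIONS --safe #-}
-- Labels are kept in a trie, written as one doubly linked list of brackets: a class of vertices with
-- equal label is the stretch between an opening and a closing item, holding first its vertices and
-- then, in order of creation, the classes whose labels extend its own.  Read from left to right the
-- labels increase, since a later letter is larger, so the last vertex in the list has a maximal label.
-- When v is numbered, a neighbour w moves to a class placed just before the closing item of its old
-- class.  A closing item carries the vertex numbered when its class was created, so comparing the item
-- before it with v tells whether the new class exists already.  An opening item followed by a closing
-- one is removed when the search for the last vertex meets it; the closing items that are skipped
-- correspond to the letters of the label found and the root.  Hence the searches are paid for by the
-- potential Σ (1 + |label|) over the vertices plus the number of brackets, which grows by at most 3
-- for each neighbour processed.
module Submission where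

open import Defs
open import Data.Bool using (true; false)
import Data.Bool as Bool
open import Data.Bool.Properties using (¬-not)
open import Data.Empty using (⊥; ⊥-elim)
open import Data.Fin using (Fin; toℕ; fromℕ<)
import Data.Fin as Fin
open import Data.Fin.Properties using (toℕ<n; toℕ-injective; fromℕ<-toℕ; toℕ-fromℕ<; ¬∀⟶∃¬)
import Data.Fin.Properties as Fin
open import Data.Integer using (+_)
import Data.Integer as ℤ
import Data.Integer.Properties as ℤ
open import Data.List using (List; []; _∷_; [_]; _++_; _∷ʳ_; length; map; mapMaybe; reverse; zip; upTo; _∷ʳ′_; initLast; allFin)
open import Data.List.Membership.Propositional using (_∈_; _∉_)
open import Data.List.Membership.Propositional.Properties using (∈-++⁺ˡ; ∈-++⁺ʳ; ∈-++⁻; ∈-∃++; ∈-insert; ∈-map⁺; ∈-map⁻; ∈-filter⁺; ∈-cartesianProduct⁺; ∈-allFin)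
open import Data.List.Properties using (∷ʳ-++; map-++; reverse-++; length-++; length-map; length-upTo; ∷-injectiveˡ; ∷-injectiveʳ; length-tabulate)
import Data.List.Relation.Binary.Lex.Strict as Lex
open import Data.List.Relation.Binary.Permutation.Propositional using (_↭_; ↭-sym; ↭-trans; ↭⇒↭ₛ; prep)
open import Data.List.Relation.Binary.Permutation.Propositional.Properties using (∈-resp-↭; shift; map⁺; mapMaybe-↭)
import Data.List.Relation.Binary.Permutation.Setoid.Properties as Permₛ
open import Data.List.Relation.Unary.All using ([]; _∷_)
open import Data.List.Relation.Unary.All.Properties using (All¬⇒¬Any; ¬Any⇒All¬)
open import Data.List.Relation.Unary.AllPairs using ([]; _∷_)
open import Data.List.Relation.Unary.Any using (here; there)
open import Data.List.Relation.Unary.Unique.Propositional using (Unique)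
open import Data.List.Relation.Unary.Unique.Propositional.Properties using (allFin⁺)
import Data.List.Relation.Unary.Unique.Propositional.Properties as Unique
open import Data.Maybe using (Maybe; just; nothing)
open import Data.Nat using (ℕ; zero; suc; _+_; _*_; _≤_; _<_; z≤n; s≤s; _≡ᵇ_; _<?_; s≤s⁻¹; _∸_)
open import Data.Nat.ListAction using (sum)
open import Data.Nat.ListAction.Properties using (sum-↭; sum-++)
open import Data.Nat.Properties
open import Data.Nat.Tactic.RingSolver using (solve-∀)
open import Data.Product using (_×_; _,_; ∃-syntax; proj₁; proj₂; swap)
open import Data.Sum using (_⊎_; inj₁; inj₂)
open import Data.Unit using (⊤; tt)
open import Data.Vec using (Vec; lookup; toList) renaming (_∷ʳ_ to _∷ʳᵛ_; [] to []ᵛ; _∷_ to _∷ᵛ_)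
import Data.Vec.Membership.DecPropositional as VecDec
open import Data.Vec.Membership.Propositional using () renaming (_∈_ to _∈ᵛ_; _∉_ to _∉ᵛ_)
open import Data.Vec.Membership.Propositional.Properties using (∈-toList⁺)
open import Data.Vec.Properties using (length-toList)
open import Data.Vec.Relation.Unary.Any using () renaming (here to hereᵛ; there to thereᵛ)
open import Function using (_∘_)
open import Function.Bundles using (Equivalence)
open import Relation.Binary.Construct.Add.Supremum.Strict (_<_) using (_<⁺_; <⁺-trans; <⁺-asym) renaming ([_] to lift<)
open import Relation.Binary.Definitions using (tri<; tri≈; tri>)
open import Relation.Binary.PropositionalEquality using (_≡_; _≢_; refl; sym; trans; cong; subst; resp₂; isEquivalence; setoid; module ≡-Reasoning)
open import Relation.Nullary using (¬_; yes; no; Dec)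
open import Relation.Nullary.Construct.Add.Supremum using () renaming ([_] to int⁺)
open import Relation.Nullary.Decidable using (dec-true; dec-false; ¬?)

open Lex using (halt; this; next)

-- A well-formed list is a path through the states of an automaton and not a nested tree, because
-- every operation of the program is surgery at an arbitrary node: a path can be cut and joined at
-- any item, whereas a tree would have to be rebuilt around it. Moreover the state at a cut yields a
-- bound for all labels to its left, from which maximality follows. The letter ∞ does not fit into
-- words of integers. The source has to come first anyway, so it is visited without a search while
-- it still stands in the root class, and no later label contains ∞. The eight steps bought by a
-- unit of potential are the cost of the longest round of the search, the removal of an empty class.
-- A neighbour costs at most 18 steps and three units, whence 42. The degrees are never summed: each
-- visit adds its directed edges to a list without duplicates, which cannot outgrow twice the number
-- of edges.

word : List ℕ → Word
word []      = []
word (i ∷ S) = word S ++ [ int⁺ i ]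

-- Lexicographic order of labels.

_≤ˡᵉˣ_ : Word → Word → Set
x ≤ˡᵉˣ y = x <ˡᵉˣ y ⊎ x ≡ y

<ˡᵉˣ-trans : ∀ {x y z} → x <ˡᵉˣ y → y <ˡᵉˣ z → x <ˡᵉˣ z
<ˡᵉˣ-trans = Lex.<-transitive isEquivalence (resp₂ _<⁺_) (<⁺-trans <-trans)

≤ˡᵉˣ⇒≯ˡᵉˣ : ∀ {x y} → x ≤ˡᵉˣ y → ¬ (y <ˡᵉˣ x)
≤ˡᵉˣ⇒≯ˡᵉˣ (inj₁ x<y) y<x = Lex.<-asymmetric sym (resp₂ _<⁺_) (<⁺-asym <-asym) x<y y<x
≤ˡᵉˣ⇒≯ˡᵉˣ {x} (inj₂ refl) x<x = ≤ˡᵉˣ⇒≯ˡᵉˣ {x} (inj₁ x<x) x<x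

<ˡᵉˣ-∷ʳ : ∀ L {a} → L <ˡᵉˣ L ++ [ a ]
<ˡᵉˣ-∷ʳ []      = halt
<ˡᵉˣ-∷ʳ (_ ∷ L) = next refl (<ˡᵉˣ-∷ʳ L)

-- The first difference is the letter after `L`, whatever `M` is. This puts all labels within one
-- subclass below the word of a later sibling.
∷ʳ-<ˡᵉˣ-∷ʳ : ∀ L M {a b} → a <⁺ b → (L ++ [ a ]) ++ M <ˡᵉˣ L ++ [ b ]
∷ʳ-<ˡᵉˣ-∷ʳ []      _ a<b = this a<b
∷ʳ-<ˡᵉˣ-∷ʳ (_ ∷ L) M a<b = next refl (∷ʳ-<ˡᵉˣ-∷ʳ L M a<b)

-- The bracket list as a path, and the order of the labels along it.

-- A word is stored with its last letter first.  The words in the tokens are not stored by the program.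
data Token (n : ℕ) : Set where
  open′ : Token n
  vert  : Fin n → List ℕ → Token n
  close : List ℕ → Fin n → Token n

-- Letters are positive, since `open′` requires `k < i`. So 0 is free to mean, in the root class,
-- that no subclass precedes.
top : List ℕ → ℕ
top []      = 0
top (i ∷ _) = i

-- at S k is a position inside the class with word S that is followed by subclasses S k′ with k′ > k only;
-- k = top S means that no subclass precedes it, so that vertices may stand there.
data Position : Set where
  before after : Position
  at           : List ℕ → ℕ → Position

data Step (N : ℕ) {n : ℕ} : Position → Token n → Position → Set where
  openRoot  : Step N before open′ (at [] 0)
  open′     : ∀ {S k i} → k < i → i ≤ N → Step N (at S k) open′ (at (i ∷ S) i)
  vert      : ∀ {S k w} → k ≡ top S → Step N (at S k) (vert w S) (at S k)
  close     : ∀ {S k i y} → Step N (at (i ∷ S) k) (close (i ∷ S) y) (at S i)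
  closeRoot : ∀ {k y} → Step N (at [] k) (close [] y) after

-- The position after a closing item depends on `S` alone. Hence a subclass can be inserted just
-- before a closing item while the rest of the path stays as it is.
step-close : ∀ {N n S k k′ y} {q : Position} →
             Step N {n} (at S k) (close S y) q → Step N {n} (at S k′) (close S y) q
step-close close     = close
step-close closeRoot = closeRoot

Item : ℕ → Set
Item n = ℕ × Token n

data Path (N : ℕ) {n : ℕ} : Position → List (Item n) → Position → Set where
  []  : ∀ {p} → Path N p [] p
  _∷_ : ∀ {p q r j t D} → Step N p t q → Path N q D r → Path N p ((j , t) ∷ D) r

module _ {N n : ℕ} where

  path-++⁺ : ∀ {p q r} {D E : List (Item n)} → Path N p D q → Path N q E r → Path N p (D ++ E) r
  path-++⁺ []       es = es
  path-++⁺ (d ∷ ds) es = d ∷ path-++⁺ ds es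

  path-++⁻ : ∀ {p r} (D : List (Item n)) {E} → Path N p (D ++ E) r →
             ∃[ q ] Path N p D q × Path N q E r
  path-++⁻ []      es       = _ , [] , es
  path-++⁻ (_ ∷ D) (d ∷ ds) with q , ds , es ← path-++⁻ D ds = q , d ∷ ds , es

  path-mono : ∀ {M p q} {D : List (Item n)} → N ≤ M → Path N p D q → Path M p D q
  path-mono N≤M []       = []
  path-mono N≤M (d ∷ ds) = step-mono d ∷ path-mono N≤M ds
    where
    step-mono : ∀ {p q t} → Step N p t q → Step _ p t q
    step-mono openRoot        = openRoot
    step-mono (open′ k<i i≤N) = open′ k<i (≤-trans i≤N N≤M)
    step-mono (vert k≡)       = vert k≡
    step-mono close           = close
    step-mono closeRoot       = closeRoot

  path-remove-vert : ∀ {p r} (D : List (Item n)) {E j w S} →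
                     Path N p (D ++ (j , vert w S) ∷ E) r → Path N p (D ++ E) r
  path-remove-vert D ds with path-++⁻ D ds
  ... | _ , ds , vert _ ∷ es = path-++⁺ ds es

Increasing : List ℕ → Set
Increasing []      = ⊤
Increasing (i ∷ S) = top S < i × Increasing S

-- The invariant of all positions reachable from `before`. Since `N` is the latest time, the bounds
-- force `k = N` inside a class created at time `N`: such a class has no subclass yet.
Good : ℕ → Position → Set
Good N (at S k) = Increasing S × top S ≤ k × k ≤ N
Good N _        = ⊤

step-good : ∀ {N n p q} {t : Token n} → Step N p t q → Good N p → Good N q
step-good openRoot        _                       = tt , z≤n , z≤n
step-good (open′ k<i i≤N) (inc , top≤k , _)       = (≤-<-trans top≤k k<i , inc) , ≤-refl , i≤N
step-good (vert _)        g                       = g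
step-good close           ((top<i , inc) , i≤k , k≤N) = inc , <⇒≤ top<i , ≤-trans i≤k k≤N
step-good closeRoot       _                       = tt

path-good : ∀ {N n p q} {D : List (Item n)} → Path N p D q → Good N p → Good N q
path-good []       g = g
path-good (d ∷ ds) g = path-good ds (step-good d g)

-- The bounds on the labels of the vertices preceding a position.
Dominates : Position → Word → Set
Dominates before   x = ⊥
Dominates after    x = ⊤
Dominates (at S k) x = (k ≡ top S → x ≤ˡᵉˣ word S) × (∀ i → k < i → x <ˡᵉˣ word (i ∷ S))

-- Entering a subclass turns the strict bound by its word into the weak bound for the vertices
-- there. Leaving it, labels bounded by an extension of its word are below every later sibling.
dominates-step : ∀ {N n p q x} {t : Token n} → Step N p t q → Good N p → Dominates p x → Dominates q x
dominates-step {x = x} (open′ {i = i} k<i _) _ (_ , x<) =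
  (λ _ → inj₁ (x< i k<i)) , λ j i<j → <ˡᵉˣ-trans (x< i k<i) (<ˡᵉˣ-∷ʳ _)
dominates-step (vert _) _ dom = dom
dominates-step (close {S} {k} {i}) ((top<i , _) , i≤k , _) (_ , x<) =
  (λ i≡top → ⊥-elim (<⇒≢ top<i (sym i≡top))) ,
  -- `suc k` is just some letter above `k`: it provides an extension of the closed word that bounds
  -- `x` from above.
  λ j i<j → <ˡᵉˣ-trans (x< (suc k) ≤-refl) (∷ʳ-<ˡᵉˣ-∷ʳ (word S) _ (lift< i<j))
dominates-step closeRoot _ _ = tt

dominates-path : ∀ {N n p q x} {D : List (Item n)} → Path N p D q → Good N p → Dominates p x → Dominates q x
dominates-path []       _ dom = dom
dominates-path (d ∷ ds) g dom = dominates-path ds (step-good d g) (dominates-step d g dom)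

dominates-∈ : ∀ {N n p q j w S} {D : List (Item n)} → Path N p D q → Good N p →
              (j , vert w S) ∈ D → Dominates q (word S)
dominates-∈ {S = S} (vert {k = k} k≡top ∷ ds) g (here refl) =
  dominates-path ds g ((λ _ → inj₂ refl) , λ _ _ → <ˡᵉˣ-∷ʳ (word S))
dominates-∈ (d ∷ ds) g (there t∈D) = dominates-∈ ds (step-good d g) t∈D

-- What the search has passed on its way from the right: the ends of all classes around the cursor.
-- There is one for each letter of `S` and one for the root, which makes exactly the weight of a
-- vertex labelled `S`.
data Closing {n : ℕ} : List ℕ → List (Item n) → Set where
  root : ∀ {j y} → Closing [] [ (j , close [] y) ]
  _∷_  : ∀ {i S D y} j → Closing S D → Closing (i ∷ S) ((j , close (i ∷ S) y) ∷ D)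

closing-path : ∀ {N n S k} {D : List (Item n)} → Closing S D → Path N (at S k) D after
closing-path root    = closeRoot ∷ []
closing-path (_ ∷ c) = close ∷ closing-path c

closing-no-vert : ∀ {n S j w T} {D : List (Item n)} → Closing S D → (j , vert w T) ∉ D
closing-no-vert root    (here ())
closing-no-vert root    (there ())
closing-no-vert (_ ∷ c) (there t∈) = closing-no-vert c t∈

-- Vertices and potential of a list.

vertexOf : ∀ {n} → Item n → Maybe (Fin n)
vertexOf (_ , vert w _) = just w
vertexOf _              = nothing

vertices : ∀ {n} → List (Item n) → List (Fin n)
vertices = mapMaybe vertexOf

weight : ∀ {n} → Item n → ℕ
weight (_ , vert _ S) = suc (length S)
weight _              = 1

potential : ∀ {n} → List (Item n) → ℕ
potential D = sum (map weight D)

potential-↭ : ∀ {n} {D E : List (Item n)} → D ↭ E → potential D ≡ potential E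
potential-↭ = sum-↭ ∘ map⁺ weight

Unique-↭ : ∀ {n} {vs ws : List (Fin n)} → vs ↭ ws → Unique vs → Unique ws
Unique-↭ p = Permₛ.Unique-resp-↭ (setoid _) (↭⇒↭ₛ p)

∈-vertices : ∀ {n j w S} {D : List (Item n)} → (j , vert w S) ∈ D → w ∈ vertices D
∈-vertices {D = _ ∷ D}                (here refl) = here refl
∈-vertices {D = (_ , open′) ∷ D}      (there t∈)  = ∈-vertices t∈
∈-vertices {D = (_ , vert _ _) ∷ D}   (there t∈)  = there (∈-vertices t∈)
∈-vertices {D = (_ , close _ _) ∷ D}  (there t∈)  = ∈-vertices t∈

-- Memory layout.

↦-same : {X : Set} (f : ℕ → X) (k : ℕ) {a : X} → (f [ k ↦ a ]) k ≡ a
↦-same f k with k ≡ᵇ k in eq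
... | true  = refl
... | false = ⊥-elim (subst Bool.T eq (≡⇒≡ᵇ k k refl))

↦-other : {X : Set} (f : ℕ → X) {j k : ℕ} {a : X} → j ≢ k → (f [ k ↦ a ]) j ≡ f j
↦-other f {j} {k} j≢k with j ≡ᵇ k in eq
... | true  = ⊥-elim (j≢k (≡ᵇ⇒≡ j k (subst Bool.T (sym eq) tt)))
... | false = refl

module Layout (G : Graph) (A : AdjacencyLists G) where
  open Graph G renaming (∣V∣ to n)
  open AdjacencyLists A

  B : ℕ
  B = integerBound G

  positionsAt classesAt outputAt listAt : ℕ
  positionsAt = 1 + n
  classesAt   = 2 + n
  outputAt    = 3 + n
  listAt      = 4 + n

  value : Token n → Value
  value open′       = int (+ 0)
  value (vert w _)  = vertexValue w
  value (close _ y) = vertexValue y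

  node : Item n → Node
  node (j , t) = j , value t

  entry : (ℕ → Value) → Vertex → Value
  entry f w = f (suc (toℕ w))

  _[_↤_] : (ℕ → Value) → Vertex → Value → (ℕ → Value)
  f [ w ↤ v ] = f [ suc (toℕ w) ↦ v ]

  entry-same : ∀ f w {v} → entry (f [ w ↤ v ]) w ≡ v
  entry-same f w = ↦-same f (suc (toℕ w))

  entry-other : ∀ f {u w v} → u ≢ w → entry (f [ w ↤ v ]) u ≡ entry f u
  entry-other f u≢w = ↦-other f (u≢w ∘ toℕ-injective ∘ suc-injective)

  -- The input occupies the addresses 0 to `n`; the three arrays and the bracket list follow in the
  -- order in which `setup` allocates them.
  record Memory (h : ℕ → Maybe Object) (f g o : ℕ → Value) (k : ℕ) (D : List (Item n)) : Set where
    field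
      adjacencyMem : h 0 ≡ just (array n listRef)
      neighbourMem : ∀ v → h (suc (toℕ v)) ≡ just (neighbourList A v)
      positionsMem : h positionsAt ≡ just (array n f)
      classesMem   : h classesAt ≡ just (array n g)
      outputMem    : h outputAt ≡ just (array n o)
      listMem      : h listAt ≡ just (dlist k (map node D))

  open Memory public

  toℕ≢n+ : ∀ (v : Vertex) k → suc (toℕ v) ≢ suc (k + n)
  toℕ≢n+ v k eq = <⇒≢ (≤-trans (toℕ<n v) (m≤n+m n k)) (suc-injective eq)

  module _ {h : ℕ → Maybe Object} {f g o k D} (M : Memory h f g o k D) where

    memory-positions : ∀ {f′} → Memory (h [ positionsAt ↦ just (array n f′) ]) f′ g o k D
    memory-positions = record
      { adjacencyMem = adjacencyMem M
      ; neighbourMem = λ v → trans (↦-other h (toℕ≢n+ v 0)) (neighbourMem M v)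
      ; positionsMem = ↦-same h positionsAt
      ; classesMem   = trans (↦-other h (>⇒≢ ≤-refl)) (classesMem M)
      ; outputMem    = trans (↦-other h (>⇒≢ (m≤n+m _ 1))) (outputMem M)
      ; listMem      = trans (↦-other h (>⇒≢ (m≤n+m _ 2))) (listMem M)
      }

    memory-classes : ∀ {g′} → Memory (h [ classesAt ↦ just (array n g′) ]) f g′ o k D
    memory-classes = record
      { adjacencyMem = adjacencyMem M
      ; neighbourMem = λ v → trans (↦-other h (toℕ≢n+ v 1)) (neighbourMem M v)
      ; positionsMem = trans (↦-other h (<⇒≢ ≤-refl)) (positionsMem M)
      ; classesMem   = ↦-same h classesAt
      ; outputMem    = trans (↦-other h (>⇒≢ ≤-refl)) (outputMem M)
      ; listMem      = trans (↦-other h (>⇒≢ (m≤n+m _ 1))) (listMem M)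
      }

    memory-output : ∀ {o′} → Memory (h [ outputAt ↦ just (array n o′) ]) f g o′ k D
    memory-output = record
      { adjacencyMem = adjacencyMem M
      ; neighbourMem = λ v → trans (↦-other h (toℕ≢n+ v 2)) (neighbourMem M v)
      ; positionsMem = trans (↦-other h (<⇒≢ (m≤n+m _ 1))) (positionsMem M)
      ; classesMem   = trans (↦-other h (<⇒≢ ≤-refl)) (classesMem M)
      ; outputMem    = ↦-same h outputAt
      ; listMem      = trans (↦-other h (>⇒≢ ≤-refl)) (listMem M)
      }

    memory-list : ∀ {k′ D′} → Memory (h [ listAt ↦ just (dlist k′ (map node D′)) ]) f g o k′ D′
    memory-list = record
      { adjacencyMem = adjacencyMem M
      ; neighbourMem = λ v → trans (↦-other h (toℕ≢n+ v 3)) (neighbourMem M v)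
      ; positionsMem = trans (↦-other h (<⇒≢ (m≤n+m _ 2))) (positionsMem M)
      ; classesMem   = trans (↦-other h (<⇒≢ (m≤n+m _ 1))) (classesMem M)
      ; outputMem    = trans (↦-other h (<⇒≢ ≤-refl)) (outputMem M)
      ; listMem      = ↦-same h listAt
      }

  -- List and array commands in terms of items and vertices.

  module _ {s : State} {k : ℕ} where

    private
      Holds : List (Item n) → Set
      Holds D = heap s listAt ≡ just (dlist k (map node D))

      split : ∀ D {E} → Holds (D ++ E) → heap s listAt ≡ just (dlist k (map node D ++ map node E))
      split D {E} eq = trans eq (cong (just ∘ dlist k) (map-++ node D E))

    valueOf-item : ∀ {x p j t} D {E} → registers s p ≡ nodeRef listAt j → Holds (D ++ (j , t) ∷ E) →
                   B ⊢ valueOf x p , s ⇓[ 1 ] setRegister x (value t) s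
    valueOf-item D p≡ eq = valueOf⇓ {ys = map node D} p≡ (split D eq)

    successor-item : ∀ {x p j t i u} D {E} → registers s p ≡ nodeRef listAt j →
                     Holds (D ++ (j , t) ∷ (i , u) ∷ E) →
                     B ⊢ successor x p , s ⇓[ 1 ] setRegister x (nodeRef listAt i) s
    successor-item D p≡ eq = successor⇓ {ys = map node D} p≡ (split D eq)

    predecessor-ref : ∀ {x p j t} D {E} → registers s p ≡ nodeRef listAt j → Holds (D ++ (j , t) ∷ E) →
                      B ⊢ predecessor x p , s ⇓[ 1 ] setRegister x (headRef listAt (reverse (map node D))) s
    predecessor-ref D p≡ eq = predecessor⇓ {ys = map node D} p≡ (split D eq)

    remove-item : ∀ {p j t} D {E} → registers s p ≡ nodeRef listAt j → Holds (D ++ (j , t) ∷ E) →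
                  B ⊢ removeNode p , s ⇓[ 1 ] store listAt (dlist k (map node (D ++ E))) s
    remove-item D {E} p≡ eq =
      subst (λ l → B ⊢ _ , s ⇓[ 1 ] store listAt (dlist k l) s) (sym (map-++ node D E))
            (removeNode⇓ {ys = map node D} p≡ (split D eq))

    insertBefore-item : ∀ {p y j t u} D {E} → registers s p ≡ nodeRef listAt j → registers s y ≡ value u →
                        Holds (D ++ (j , t) ∷ E) →
                        B ⊢ insertBefore p y , s ⇓[ 1 ]
                          store listAt (dlist (suc k) (map node (D ++ (k , u) ∷ (j , t) ∷ E))) s
    insertBefore-item {j = j} {t} {u} D {E} p≡ y≡ eq =
      subst (λ l → B ⊢ _ , s ⇓[ 1 ] store listAt (dlist (suc k) l) s)
            (trans (cong (λ v → map node D ++ (k , v) ∷ map node ((j , t) ∷ E)) y≡)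
                   (sym (map-++ node D ((k , u) ∷ (j , t) ∷ E))))
            (insertBefore⇓ {ys = map node D} p≡ (split D eq))

  headRef-∷ʳ : ∀ D {j t} → headRef listAt (reverse (map node (D ∷ʳ (j , t)))) ≡ nodeRef listAt j
  headRef-∷ʳ D {j} {t} = cong (headRef listAt)
    (trans (cong reverse (map-++ node D _)) (reverse-++ (map node D) [ node (j , t) ]))

  predecessor-item : ∀ {s k x p i u j t} D {E} → registers s p ≡ nodeRef listAt j →
                     heap s listAt ≡ just (dlist k (map node (D ++ (i , u) ∷ (j , t) ∷ E))) →
                     B ⊢ predecessor x p , s ⇓[ 1 ] setRegister x (nodeRef listAt i) s
  predecessor-item {s} {k} {x} {p} D {E} p≡ eq =
    subst (λ v → B ⊢ predecessor x p , s ⇓[ 1 ] setRegister x v s) (headRef-∷ʳ D)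
          (predecessor-ref (D ∷ʳ _) p≡
            (trans eq (cong (just ∘ dlist k ∘ map node) (sym (∷ʳ-++ D _ _)))))

  read-entry : ∀ {s x a i b f w v} → registers s a ≡ arrayRef b → heap s b ≡ just (array n f) →
               registers s i ≡ vertexValue w → entry f w ≡ v →
               B ⊢ x := a ⟨ i ⟩ , s ⇓[ 1 ] setRegister x v s
  read-entry {w = w} a≡ h≡ i≡ refl = read⇓ a≡ h≡ i≡ (s≤s z≤n) (toℕ<n w)

  write-entry : ∀ {s y a i b f w v} → registers s a ≡ arrayRef b → heap s b ≡ just (array n f) →
                registers s i ≡ vertexValue w → registers s y ≡ v →
                B ⊢ a ⟨ i ⟩:= y , s ⇓[ 1 ] store b (array n (f [ w ↤ v ])) s
  write-entry {w = w} a≡ h≡ i≡ refl = write⇓ a≡ h≡ i≡ (s≤s z≤n) (toℕ<n w)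

  -- The invariant that links list, arrays and labels.

  -- U is the set of vertices in the list and Stamp i y says that y may mark the closing item of a class
  -- created at time i; f and g map a vertex to its own item and to the closing item of its class.
  module _ (f g : ℕ → Value) (U : Vertex → Set) (Lab : Vertex → List ℕ → Set) (Stamp : ℕ → Vertex → Set) where

    ItemOk : List (Item n) → Item n → Set
    ItemOk D (j , open′)           = ⊤
    ItemOk D (j , vert w S)        = U w × Lab w S × entry f w ≡ nodeRef listAt j ×
                                     ∃[ i ] ∃[ y ] ((i , close S y) ∈ D × entry g w ≡ nodeRef listAt i)
    -- `rootReg` holds node 1 during the whole search and all visits, so the end of the root is
    -- known by its identifier; it belongs to no numbering time.
    ItemOk D (j , close [] y)      = j ≡ 1
    ItemOk D (j , close (i ∷ S) y) = Stamp i y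

    record Consistent (D : List (Item n)) : Set where
      field
        itemOk  : ∀ {t} → t ∈ D → ItemOk D t
        unique-vertices : Unique (vertices D)
        covers  : ∀ {w} → U w → ∃[ j ] ∃[ S ] (j , vert w S) ∈ D

  open Consistent public

  item-resp : ∀ {f g U Lab Stamp D E} →
              (∀ {i S y} → (i , close S y) ∈ D → (i , close S y) ∈ E) →
              ∀ t → ItemOk f g U Lab Stamp D t → ItemOk f g U Lab Stamp E t
  item-resp close⊆ (_ , open′)           _ = tt
  item-resp close⊆ (_ , vert _ _)        (u , lab , pos , i , y , c∈ , cls) = u , lab , pos , i , y , close⊆ c∈ , cls
  item-resp close⊆ (_ , close [] _)      j≡1 = j≡1
  item-resp close⊆ (_ , close (_ ∷ _) _) st = st

  consistent-↭ : ∀ {f g U Lab Stamp D E} → D ↭ E →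
                 Consistent f g U Lab Stamp D → Consistent f g U Lab Stamp E
  consistent-↭ {f} {g} {U} {Lab} {Stamp} p C = record
    { itemOk  = λ {t} t∈ → item-resp {f} {g} {U} {Lab} {Stamp} (∈-resp-↭ p) t (itemOk C (∈-resp-↭ (↭-sym p) t∈))
    ; unique-vertices = Unique-↭ (mapMaybe-↭ vertexOf p) (unique-vertices C)
    ; covers  = λ u → let j , S , t∈ = covers C u in j , S , ∈-resp-↭ p t∈
    }

  consistent-map : ∀ {f g U V Lab Lab′ Stamp Stamp′ D} →
                   (∀ {w} → U w → V w) → (∀ {w} → V w → U w) →
                   (∀ {w S} → U w → Lab w S → Lab′ w S) → (∀ {i y} → Stamp i y → Stamp′ i y) →
                   Consistent f g U Lab Stamp D → Consistent f g V Lab′ Stamp′ D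
  consistent-map {f} {g} {U} {V} {Lab} {Lab′} {Stamp} {Stamp′} {D} to from lab stamp C = record
    { itemOk = λ {t} t∈ → item t (itemOk C t∈) ; unique-vertices = unique-vertices C ; covers = λ v → covers C (from v) }
    where
    item : ∀ t → ItemOk f g U Lab Stamp D t → ItemOk f g V Lab′ Stamp′ D t
    item (_ , open′)           _            = tt
    item (_ , vert _ _)        (u , l , ok) = to u , lab u l , ok
    item (_ , close [] _)      j≡1          = j≡1
    item (_ , close (_ ∷ _) _) st           = stamp st

  consistent-drop-vert : ∀ {f g U Lab Stamp D j v S} →
                         Consistent f g U Lab Stamp ((j , vert v S) ∷ D) →
                         Consistent f g (λ w → U w × w ≢ v) Lab Stamp D
  consistent-drop-vert {f} {g} {U} {Lab} {Stamp} {D} {j} {v} {S} C with v∉ ∷ uniq ← unique-vertices C = record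
    { itemOk  = λ {t} t∈ → item t t∈ (itemOk C (there t∈))
    ; unique-vertices = uniq
    ; covers  = cover
    }
    where
    item : ∀ t → t ∈ D → ItemOk f g U Lab Stamp ((j , vert v S) ∷ D) t →
           ItemOk f g (λ w → U w × w ≢ v) Lab Stamp D t
    item (_ , open′)           _  _ = tt
    item (_ , vert _ _)        t∈ (u , l , pos , i , y , there c∈ , cls) =
      (u , λ { refl → All¬⇒¬Any v∉ (∈-vertices t∈) }) , l , pos , i , y , c∈ , cls
    item (_ , close [] _)      _ j≡1 = j≡1
    item (_ , close (_ ∷ _) _) _ st = st
    cover : ∀ {w} → U w × w ≢ v → ∃[ j ] ∃[ T ] (j , vert w T) ∈ D
    cover (u , w≢v) with covers C u
    ... | _ , _ , here refl = ⊥-elim (w≢v refl)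
    ... | _ , _ , there t∈  = _ , _ , t∈

  ∈-vertices⁻ : ∀ {w : Vertex} (D : List (Item n)) → w ∈ vertices D → ∃[ j ] ∃[ S ] (j , vert w S) ∈ D
  ∈-vertices⁻ ((_ , vert _ _) ∷ D) (here refl) = _ , _ , here refl
  ∈-vertices⁻ ((_ , vert _ _) ∷ D) (there w∈) with _ , _ , t∈ ← ∈-vertices⁻ D w∈ = _ , _ , there t∈
  ∈-vertices⁻ ((_ , open′) ∷ D)     w∈ with _ , _ , t∈ ← ∈-vertices⁻ D w∈ = _ , _ , there t∈
  ∈-vertices⁻ ((_ , close _ _) ∷ D) w∈ with _ , _ , t∈ ← ∈-vertices⁻ D w∈ = _ , _ , there t∈

  -- `¬ U w` is what makes the two array writes harmless: they overwrite entries of no vertex that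
  -- is already listed.
  consistent-add-vert : ∀ {f g U Lab Stamp D k w S i y} →
                        Consistent f g U Lab Stamp D → ¬ U w → Lab w S → (i , close S y) ∈ D →
                        Consistent (f [ w ↤ nodeRef listAt k ]) (g [ w ↤ nodeRef listAt i ])
                                   (λ u → U u ⊎ u ≡ w) Lab Stamp ((k , vert w S) ∷ D)
  consistent-add-vert {f} {g} {U} {Lab} {Stamp} {D} {k} {w} {S} {i} {y} C ¬Uw lab c∈ = record
    { itemOk  = λ { (here refl) → inj₂ refl , lab , entry-same f w , i , y , there c∈ , entry-same g w
                  ; {t} (there t∈) → item t (itemOk C t∈) }
    ; unique-vertices = ¬Any⇒All¬ _ w∉ ∷ unique-vertices C
    ; covers  = λ { (inj₁ u) → let j , S , t∈ = covers C u in j , S , there t∈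
                  ; (inj₂ refl) → k , S , here refl }
    }
    where
    item : ∀ t → ItemOk f g U Lab Stamp D t →
           ItemOk (f [ w ↤ nodeRef listAt k ]) (g [ w ↤ nodeRef listAt i ])
                  (λ u → U u ⊎ u ≡ w) Lab Stamp ((k , vert w S) ∷ D) t
    item (_ , open′)           _ = tt
    item (_ , vert u _)        (Uu , l , pos , i , y , c∈ , cls) =
      inj₁ Uu , l , trans (entry-other f u≢w) pos , i , y , there c∈ , trans (entry-other g u≢w) cls
      where
      u≢w : u ≢ w
      u≢w refl = ¬Uw Uu
    item (_ , close [] _)      j≡1 = j≡1
    item (_ , close (_ ∷ _) _) st  = st
    w∉ : w ∉ vertices D
    w∉ w∈ = let _ , _ , t∈ = ∈-vertices⁻ D w∈ in ¬Uw (proj₁ (itemOk C t∈))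

  consistent-add-class : ∀ {f g U Lab Stamp D j k i S y} → Consistent f g U Lab Stamp D → Stamp i y →
                         Consistent f g U Lab Stamp ((j , open′) ∷ (k , close (i ∷ S) y) ∷ D)
  consistent-add-class {f} {g} {U} {Lab} {Stamp} C st = record
    { itemOk  = λ { (here refl) → tt ; (there (here refl)) → st
                  ; {t} (there (there t∈)) → item-resp {f} {g} {U} {Lab} {Stamp} (there ∘ there) t (itemOk C t∈) }
    ; unique-vertices = unique-vertices C
    ; covers  = λ u → let j , S , t∈ = covers C u in j , S , there (there t∈)
    }

  -- The closing item to which a vertex points bears the label of that vertex. So only vertices
  -- labelled `S` could be left with a dangling class entry, and the last hypothesis excludes them.
  consistent-drop-class : ∀ {f g U Lab Stamp D j k S y} →
                          Consistent f g U Lab Stamp ((j , open′) ∷ (k , close S y) ∷ D) →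
                          (∀ {l w T} → (l , vert w T) ∈ D → T ≢ S) →
                          Consistent f g U Lab Stamp D
  consistent-drop-class {f} {g} {U} {Lab} {Stamp} {D} {j} {k} {S} {y} C empty = record
    { itemOk  = λ {t} t∈ → item t t∈ (itemOk C (there (there t∈)))
    ; unique-vertices = unique-vertices C
    ; covers  = cover
    }
    where
    item : ∀ t → t ∈ D → ItemOk f g U Lab Stamp ((j , open′) ∷ (k , close S y) ∷ D) t →
           ItemOk f g U Lab Stamp D t
    item (_ , open′)           _  _ = tt
    item (_ , vert _ _)        t∈ (u , l , pos , i , y , there (here refl) , cls) = ⊥-elim (empty t∈ refl)
    item (_ , vert _ _)        t∈ (u , l , pos , i , y , there (there c∈) , cls) = u , l , pos , i , y , c∈ , cls
    item (_ , close [] _)      _ j≡1 = j≡1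
    item (_ , close (_ ∷ _) _) _ st = st
    cover : ∀ {w} → U w → ∃[ j ] ∃[ T ] (j , vert w T) ∈ D
    cover u with covers C u
    ... | _ , _ , there (there t∈) = _ , _ , t∈

-- Amortised time and execution rules for tests.

potential-++ : ∀ {n} (D E : List (Item n)) → potential (D ++ E) ≡ potential D + potential E
potential-++ D E = trans (cong sum (map-++ weight D E)) (sum-++ (map weight D) (map weight E))

potential-closing : ∀ {n S} {D : List (Item n)} → Closing S D → potential D ≡ suc (length S)
potential-closing root    = refl
potential-closing (_ ∷ c) = cong suc (potential-closing c)

-- Time amortised against a potential φ, each unit of which pays for eight steps.
Terminates : ℕ → Command → State → ℕ → (State → ℕ → Set) → Set
Terminates B c s b Q = ∃[ t ] ∃[ s′ ] ∃[ φ ] ((B ⊢ c , s ⇓[ t ] s′) × t + φ * 8 ≤ b × Q s′ φ)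

module _ {B : ℕ} {s : State} where

  private
    r : Register → Value
    r = registers s

  whileNil⇓ : ∀ {x c s′ s″ t u} → r x ≡ nil → B ⊢ c , s ⇓[ t ] s′ → B ⊢ while (isNil x) c , s′ ⇓[ u ] s″ →
              B ⊢ while (isNil x) c , s ⇓[ suc (t + u) ] s″
  whileNil⇓ {x} x≡ = whileTrue⇓ test
    where
    test : evaluate (isNil x) r ≡ just true
    test rewrite x≡ = refl

  whileNode⇓ : ∀ {x c b j} → r x ≡ nodeRef b j → B ⊢ while (isNil x) c , s ⇓[ 1 ] s
  whileNode⇓ {x} x≡ = whileFalse⇓ test
    where
    test : evaluate (isNil x) r ≡ just false
    test rewrite x≡ = refl

  ifNil⇓ : ∀ {x c d s′ t} → r x ≡ nil → B ⊢ c , s ⇓[ t ] s′ → B ⊢ ifThenElse (isNil x) c d , s ⇓[ suc t ] s′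
  ifNil⇓ {x} x≡ = ifTrue⇓ test
    where
    test : evaluate (isNil x) r ≡ just true
    test rewrite x≡ = refl

  ifNode⇓ : ∀ {x b j c d s′ t} → r x ≡ nodeRef b j → B ⊢ d , s ⇓[ t ] s′ →
            B ⊢ ifThenElse (isNil x) c d , s ⇓[ suc t ] s′
  ifNode⇓ {x} x≡ = ifFalse⇓ test
    where
    test : evaluate (isNil x) r ≡ just false
    test rewrite x≡ = refl

  ifEqual⇓ : ∀ {x y i j c d s′ t} → r x ≡ int i → r y ≡ int j → i ≡ j → B ⊢ c , s ⇓[ t ] s′ →
             B ⊢ ifThenElse (x equals y) c d , s ⇓[ suc t ] s′
  ifEqual⇓ {x} {y} {i} {j} x≡ y≡ i≡j = ifTrue⇓ test
    where
    test : evaluate (x equals y) r ≡ just true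
    test rewrite x≡ | y≡ = cong just (dec-true (i ℤ.≟ j) i≡j)

  ifUnequal⇓ : ∀ {x y i j c d s′ t} → r x ≡ int i → r y ≡ int j → i ≢ j → B ⊢ d , s ⇓[ t ] s′ →
               B ⊢ ifThenElse (x equals y) c d , s ⇓[ suc t ] s′
  ifUnequal⇓ {x} {y} {i} {j} x≡ y≡ i≢j = ifFalse⇓ test
    where
    test : evaluate (x equals y) r ≡ just false
    test rewrite x≡ | y≡ = cong just (dec-false (i ℤ.≟ j) i≢j)

  whileLess⇓ : ∀ {x y i j c s′ s″ t u} → r x ≡ int (+ i) → r y ≡ int (+ j) → i < j →
               B ⊢ c , s ⇓[ t ] s′ → B ⊢ while (x lessThan y) c , s′ ⇓[ u ] s″ →
               B ⊢ while (x lessThan y) c , s ⇓[ suc (t + u) ] s″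
  whileLess⇓ {x} {y} {i} {j} x≡ y≡ i<j = whileTrue⇓ test
    where
    test : evaluate (x lessThan y) r ≡ just true
    test rewrite x≡ | y≡ = cong just (dec-true (+ i ℤ.<? + j) (ℤ.+<+ i<j))

  whileNotLess⇓ : ∀ {x y i j c} → r x ≡ int (+ i) → r y ≡ int (+ j) → ¬ (i < j) →
                  B ⊢ while (x lessThan y) c , s ⇓[ 1 ] s
  whileNotLess⇓ {x} {y} {i} {j} x≡ y≡ i≮j = whileFalse⇓ test
    where
    test : evaluate (x lessThan y) r ≡ just false
    test rewrite x≡ | y≡ = cong just (dec-false (+ i ℤ.<? + j) (i≮j ∘ ℤ.drop‿+<+))

-- The search for the last vertex.

pattern adjacencyReg  = 0
pattern sizeReg       = 1
pattern sourceReg     = 2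
pattern rootReg       = 3
pattern positionsReg  = 4
pattern classesReg    = 5
pattern outputReg     = 6
pattern counterReg    = 7
pattern zeroReg       = 8
pattern cursorReg     = 9
pattern chosenReg     = 10
pattern valueReg      = 11
pattern itemReg       = 12
pattern neighbourReg  = 13
pattern classReg      = 14
pattern flagReg       = 15

findBody find : Command
findBody =
  valueOf chosenReg cursorReg ⨾
  ifThenElse (chosenReg equals zeroReg)
    (successor itemReg cursorReg ⨾
     removeNode itemReg ⨾
     predecessor itemReg cursorReg ⨾
     removeNode cursorReg ⨾
     cursorReg := itemReg)
    -- The entry read here decides whether the loop goes on. The mark of a closing item is a
    -- numbered vertex, whose entry is nil; a vertex in the list has a node there.
    (classReg := classesReg ⟨ chosenReg ⟩ ⨾
     predecessor cursorReg cursorReg)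
find =
  predecessor cursorReg rootReg ⨾
  :=nil classReg ⨾
  while (isNil classReg) findBody

module Search (G : Graph) (A : AdjacencyLists G) where
  open Graph G renaming (∣V∣ to n)
  open AdjacencyLists A
  open Layout G A

  Terminating : Command → State → ℕ → (State → ℕ → Set) → Set
  Terminating = Terminates B

  record RegisterValues (i : ℕ) (r₀ r₁ r₃ r₄ r₅ r₆ r₇ r₈ : Value) : Set where
    field
      adjacency≡ : r₀ ≡ arrayRef 0
      size≡      : r₁ ≡ int (+ n)
      root≡      : r₃ ≡ nodeRef listAt 1
      positions≡ : r₄ ≡ arrayRef positionsAt
      classes≡   : r₅ ≡ arrayRef classesAt
      output≡    : r₆ ≡ arrayRef outputAt
      counter≡   : r₇ ≡ int (+ i)
      zero≡      : r₈ ≡ int (+ 0)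

  open RegisterValues public

  -- Indexed by the values, so that it is invariant under assignments to scratch registers by computation.
  Registers : ℕ → State → Set
  Registers i s = RegisterValues i (r adjacencyReg) (r sizeReg) (r rootReg) (r positionsReg)
                    (r classesReg) (r outputReg) (r counterReg) (r zeroReg)
    where r = registers s

  remove-next : ∀ {s k p i u j t} D {E} → registers s p ≡ nodeRef listAt j →
                heap s listAt ≡ just (dlist k (map node (D ++ (i , u) ∷ (j , t) ∷ E))) →
                B ⊢ removeNode p , s ⇓[ 1 ] store listAt (dlist k (map node (D ++ (i , u) ∷ E))) s
  remove-next {s} {k} {p} D p≡ eq =
    subst (λ l → B ⊢ removeNode p , s ⇓[ 1 ] store listAt (dlist k (map node l)) s) (∷ʳ-++ D _ _)
      (remove-item (D ∷ʳ _) p≡ (trans eq (cong (just ∘ dlist k ∘ map node) (sym (∷ʳ-++ D _ _)))))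

  module _ (f g o : ℕ → Value) (U : Vertex → Set) (Lab : Vertex → List ℕ → Set) (Stamp : ℕ → Vertex → Set)
           (N : ℕ) where

    -- The potential left is that of the list without the found vertex, although `visit` has yet to
    -- remove it: its weight has been spent on the closing items passed by the search.
    record Found (i : ℕ) (s : State) (φ : ℕ) : Set where
      field
        {fresh position} : ℕ
        left right   : List (Item n)
        {vertex}     : Vertex
        {label}      : List ℕ
      items : List (Item n)
      items = left ++ (position , vert vertex label) ∷ right
      field
        registersOk  : Registers i s
        chosen≡      : registers s chosenReg ≡ vertexValue vertex
        memory       : Memory (heap s) f g o fresh items
        path         : Path N before items after
        consistent   : Consistent f g U Lab Stamp items
        potential≡   : potential (left ++ right) ≡ φ
        maximal      : ∀ {j w S} → (j , vert w S) ∈ items → word S ≤ˡᵉˣ word label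

    module _ (stamp-nil : ∀ {i y} → Stamp i y → entry g y ≡ nil) where

      -- `ys` is still to be searched, `cs` has been passed. The budget counts `ys` only, since the
      -- units of `cs` are spent; at the end the weight of the vertex found equals `potential cs`
      -- and restores them. `m` makes the recursion structural, and the vertex in `ys` keeps the
      -- search from reaching the opening of the root.
      findLoop : ∀ m {i s k D} ys cs {S l} → D ≡ ys ++ cs → length ys < m →
                 Registers i s →
                 registers s cursorReg ≡ headRef listAt (reverse (map node ys)) →
                 registers s classReg ≡ nil →
                 Memory (heap s) f g o k D → Consistent f g U Lab Stamp D →
                 Path N before ys (at S l) → Closing S cs →
                 (∃[ j ] ∃[ w ] ∃[ T ] (j , vert w T) ∈ ys) →
                 Terminating (while (isNil classReg) findBody) s (9 + potential ys * 8) (Found i)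
      findLoop (suc m) {i} {s} {k} ys cs D≡ len<m R cur≡ cls≡ M C ds cl (_ , _ , _ , t∈) with initLast ys
      ... | xs ∷ʳ′ (j , t) with path-++⁻ xs ds
      ...   | _ , ds , st ∷ [] = step st t∈ (trans D≡ (∷ʳ-++ xs _ cs)) (trans cur≡ (headRef-∷ʳ xs)) ds cl M C
        where
        open ≤-Reasoning
        len : length xs < m
        len = s≤s⁻¹ (≤-trans (s≤s (≤-reflexive (sym (trans (length-++ xs) (+-comm (length xs) 1))))) len<m)
        pot : ∀ u → potential (xs ∷ʳ u) ≡ potential xs + weight u
        pot u = trans (potential-++ xs [ u ]) (cong (λ w → potential xs + w) (+-identityʳ _))
        amortise : ∀ {u} d → weight u ≡ 1 → d ≤ 8 → ∀ t φ → t + φ * 8 ≤ 9 + potential xs * 8 →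
               d + t + φ * 8 ≤ 9 + potential (xs ∷ʳ u) * 8
        amortise {u} d w≡1 d≤8 t φ le = begin
          d + t + φ * 8                 ≡⟨ +-assoc d t _ ⟩
          d + (t + φ * 8)               ≤⟨ +-mono-≤ d≤8 le ⟩
          8 + (9 + potential xs * 8)    ≡⟨ lemma (potential xs) ⟩
          9 + (potential xs + 1) * 8    ≡⟨ cong (λ w → 9 + w * 8)
                                            (trans (cong (λ w → potential xs + w) (sym w≡1)) (sym (pot u))) ⟩
          9 + potential (xs ∷ʳ u) * 8   ∎
          where
          lemma : ∀ p → 8 + (9 + p * 8) ≡ 9 + (p + 1) * 8
          lemma = solve-∀
        still : ∀ {l w T u} → (∀ {w T} → u ≢ vert w T) → (l , vert w T) ∈ xs ∷ʳ (j , u) →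
                (l , vert w T) ∈ xs
        still u≢ t∈ with ∈-++⁻ xs t∈
        ... | inj₁ t∈xs        = t∈xs
        ... | inj₂ (here refl) = ⊥-elim (u≢ refl)
        step : ∀ {p S l t D a b T} → Step N p t (at S l) → (a , vert b T) ∈ xs ∷ʳ (j , t) → D ≡ xs ++ (j , t) ∷ cs →
               registers s cursorReg ≡ nodeRef listAt j → Path N before xs p → Closing S cs →
               Memory (heap s) f g o k D → Consistent f g U Lab Stamp D →
               Terminating (while (isNil classReg) findBody) s (9 + potential (xs ∷ʳ (j , t)) * 8) (Found i)
        -- No vertex precedes the opening of the root, because `Dominates before` is empty.
        step openRoot t∈ refl c≡ ds cl M C = ⊥-elim (dominates-∈ ds _ (still (λ ()) t∈))
        step (vert {S} {l} {w} l≡top) t∈ refl c≡ ds cl M C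
          with _ , lab , pos , c , y , _ , class≡ ← itemOk C (∈-insert xs {cs}) =
          _ , _ , potential (xs ++ cs) ,
          whileNil⇓ cls≡
            (seq⇓ (valueOf-item xs c≡ (listMem M))
              (ifUnequal⇓ refl (zero≡ R) (λ ())
                (seq⇓ (read-entry (classes≡ R) (classesMem M) refl class≡)
                      (predecessor-ref xs c≡ (listMem M)))))
            (whileNode⇓ refl) ,
          enough ,
          record
            { left = xs ; right = cs ; registersOk = R ; chosen≡ = refl ; memory = M
            ; path = path-++⁺ ds (vert l≡top ∷ closing-path cl) ; consistent = C
            ; potential≡ = refl ; maximal = maximum }
          where
          enough : 6 + potential (xs ++ cs) * 8 ≤ 9 + potential (xs ∷ʳ (j , vert w S)) * 8
          enough = +-mono-≤ (m≤n+m 6 3) (≤-reflexive (cong (_* 8)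
            (trans (potential-++ xs cs) (trans (cong (λ w → potential xs + w) (potential-closing cl)) (sym (pot _))))))
          maximum : ∀ {l w′ T} → (l , vert w′ T) ∈ xs ++ (j , vert w S) ∷ cs → word T ≤ˡᵉˣ word S
          maximum t∈ with ∈-++⁻ xs t∈
          ... | inj₁ t∈xs         = proj₁ (dominates-∈ ds _ t∈xs) l≡top
          ... | inj₂ (here refl)  = inj₂ refl
          ... | inj₂ (there t∈cs) = ⊥-elim (closing-no-vert cl t∈cs)
        step (close {S} {y = y}) t∈ refl c≡ ds cl M C =
          let u , s′ , φ , run , le , Q = findLoop m {s = setRegister cursorReg (headRef listAt (reverse (map node xs)))
                              (setRegister classReg nil (setRegister chosenReg (vertexValue y) s))}
                    xs _ refl len R refl refl M C ds (j ∷ cl) (_ , _ , _ , still (λ ()) t∈) in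
          _ , s′ , φ ,
          whileNil⇓ cls≡
            (seq⇓ (valueOf-item xs c≡ (listMem M))
              (ifUnequal⇓ refl (zero≡ R) (λ ())
                (seq⇓ (read-entry (classes≡ R) (classesMem M) refl (stamp-nil (itemOk C (∈-insert xs {cs}))))
                      (predecessor-ref xs c≡ (listMem M)))))
            run ,
          amortise 5 refl (m≤n+m 5 3) u φ le , Q
        step (open′ {S} k<i i≤N) t∈ refl c≡ ds (_∷_ {D = cs′} {y} l cl) M C
          = let u , s′ , φ , run , le , Q = findLoop m {s = setRegister cursorReg (headRef listAt (reverse (map node xs)))
                              (store listAt (dlist k (map node (xs ++ cs′)))
                                (setRegister itemReg (headRef listAt (reverse (map node xs)))
                                  (store listAt (dlist k (map node (xs ++ (j , open′) ∷ cs′)))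
                                    (setRegister itemReg (nodeRef listAt l)
                                      (setRegister chosenReg (int (+ 0)) s)))))}
                    xs _ refl len R refl cls≡ (memory-list M′)
                    (consistent-drop-class (consistent-↭ pair C) empty) ds cl (_ , _ , _ , still (λ ()) t∈) in
          _ , s′ , φ ,
          whileNil⇓ cls≡
            (seq⇓ (valueOf-item xs c≡ (listMem M))
              (ifEqual⇓ refl (zero≡ R) refl
                (seq⇓ (successor-item xs c≡ (listMem M))
                  (seq⇓ (remove-next xs refl (listMem M))
                    (seq⇓ (predecessor-ref xs c≡ (listMem M′))
                      (seq⇓ (remove-item xs c≡ (listMem M′)) assign⇓))))))
            run ,
          amortise 8 refl ≤-refl u φ le , Q
          where
          M′ : Memory _ f g o k (xs ++ (j , open′) ∷ cs′)
          M′ = memory-list M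
          pair : xs ++ (j , open′) ∷ (l , close _ y) ∷ cs′ ↭ (j , open′) ∷ (l , close _ y) ∷ xs ++ cs′
          pair = ↭-trans (shift _ xs _) (prep _ (shift _ xs _))
          -- Left of the opening item all labels are strictly below the word of the class, by
          -- dominance at a position with `k < i`; to the right there are closing items only.
          empty : ∀ {j w T} → (j , vert w T) ∈ xs ++ cs′ → T ≢ _ ∷ S
          empty t∈ refl with ∈-++⁻ xs t∈
          ... | inj₁ t∈xs = ≤ˡᵉˣ⇒≯ˡᵉˣ (inj₂ refl) (proj₂ (dominates-∈ ds _ t∈xs) _ k<i)
          ... | inj₂ t∈cs = closing-no-vert cl t∈cs

-- Numbering a vertex and moving its neighbours.

place relocate scanBody scan visit : Command
place =
  insertBefore classReg neighbourReg ⨾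
  predecessor itemReg classReg ⨾
  positionsReg ⟨ neighbourReg ⟩:= itemReg ⨾
  classesReg ⟨ neighbourReg ⟩:= classReg
relocate =
  itemReg := positionsReg ⟨ neighbourReg ⟩ ⨾
  removeNode itemReg ⨾
  predecessor itemReg classReg ⨾
  valueOf valueReg itemReg ⨾
  ifThenElse (valueReg equals chosenReg)
    (classReg := itemReg)
    -- The new class is built from right to left, the closing item before the opening one. So
    -- `classReg` is left at the closing item, in front of which `place` inserts the vertex.
    (insertBefore classReg chosenReg ⨾
     predecessor classReg classReg ⨾
     insertBefore classReg zeroReg) ⨾
  place
scanBody =
  ifThenElse (isNil cursorReg)
    -- A loop can only be run while a register is nil, but the scan has to stop when the cursor
    -- becomes nil. Any non-nil value in the flag ends it.
    (flagReg := rootReg)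
    (valueOf neighbourReg cursorReg ⨾
     successor cursorReg cursorReg ⨾
     classReg := classesReg ⟨ neighbourReg ⟩ ⨾
     ifThenElse (isNil classReg) skip relocate)
scan = while (isNil flagReg) scanBody
visit =
  increment counterReg ⨾
  outputReg ⟨ counterReg ⟩:= chosenReg ⨾
  itemReg := positionsReg ⟨ chosenReg ⟩ ⨾
  removeNode itemReg ⨾
  -- This nil serves twice: it becomes the class entry of the numbered vertex and it starts the
  -- scan.
  :=nil flagReg ⨾
  classesReg ⟨ chosenReg ⟩:= flagReg ⨾
  cursorReg := adjacencyReg ⟨ chosenReg ⟩ ⨾
  firstOf cursorReg cursorReg ⨾
  scan

module Visits (G : Graph) (A : AdjacencyLists G) where
  open Graph G renaming (∣V∣ to n)
  open AdjacencyLists A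
  open Layout G A
  open Search G A

  root-last : ∀ {f g U Lab Stamp N D} → Path N before D after → Consistent f g U Lab Stamp D →
              ∃[ E ] ∃[ y ] ∃[ l ] (D ≡ E ∷ʳ (1 , close [] y) × Path N before E (at [] l))
  root-last {D = D} ds C with initLast D
  root-last () C | []
  ... | E ∷ʳ′ _ with path-++⁻ E ds
  ...   | _ , ds , closeRoot {y = y} ∷ [] with refl ← itemOk C (∈-insert E {[]}) = E , y , _ , refl , ds

  find-terminates : ∀ {s f g o k D i U Lab Stamp N w} → Registers i s → Memory (heap s) f g o k D →
                    Consistent f g U Lab Stamp D → Path N before D after →
                    (∀ {i y} → Stamp i y → entry g y ≡ nil) → U w →
                    Terminating find s (3 + potential D * 8) (Found f g o U Lab Stamp N i)
  find-terminates {s} {i = i} {U} {Lab} {Stamp} {N} R M C ds stamp-nil Uw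
    with ys , y , _ , refl , ds ← root-last ds C =
    let j , S , w∈ = covers C Uw
        t , s′ , φ , run , le , Q = findLoop _ _ _ U Lab Stamp N stamp-nil (suc (length ys)) {s = s₁} ys
          [ (1 , close [] y) ] refl ≤-refl R refl refl M C ds root (j , _ , S , vert∈ w∈)
    in _ , s′ , φ , seq⇓ (predecessor-ref ys (root≡ R) (listMem M)) (seq⇓ nil⇓ run) ,
       (begin
         2 + t + φ * 8            ≤⟨ +-monoʳ-≤ 2 le ⟩
         -- Eight of the eleven steps are charged to the unit of the closing item of the root.
         2 + (9 + potential ys * 8)  ≡⟨ lemma (potential ys) ⟩
         3 + (potential ys + 1) * 8  ≡⟨ cong (λ p → 3 + p * 8) (sym (potential-++ ys [ (1 , close [] y) ])) ⟩
         3 + potential (ys ∷ʳ (1 , close [] y)) * 8 ∎) , Q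
    where
    open ≤-Reasoning
    s₁ : State
    s₁ = setRegister classReg nil (setRegister cursorReg (headRef listAt (reverse (map node ys))) s)
    lemma : ∀ p → 2 + (9 + p * 8) ≡ 3 + (p + 1) * 8
    lemma = solve-∀
    vert∈ : ∀ {j w S} → (j , vert w S) ∈ ys ∷ʳ (1 , close [] y) → (j , vert w S) ∈ ys
    vert∈ t∈ with ∈-++⁻ ys t∈
    ... | inj₁ t∈ys      = t∈ys
    ... | inj₂ (here ())

  -- `N` bounds the letters in the list and `i` is the value of the counter. They agree during the
  -- visits, but while the root class is filled the counter runs through the vertices and `N` stays
  -- 0.
  record Tracking (U : Vertex → Set) (Lab : Vertex → List ℕ → Set) (Stamp : ℕ → Vertex → Set) (N : ℕ)
                  (o : ℕ → Value) (i : ℕ) (s : State) (φ : ℕ) : Set where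
    field
      {positions classes} : ℕ → Value
      {fresh}             : ℕ
      {items}             : List (Item n)
      registersOk : Registers i s
      memory      : Memory (heap s) positions classes o fresh items
      path        : Path N before items after
      consistent  : Consistent positions classes U Lab Stamp items
      classes-nil : ∀ {w} → ¬ U w → entry classes w ≡ nil
      potential≡  : potential items ≡ φ

  open Tracking

  vertexValue-injective : ∀ {v w : Vertex} → + suc (toℕ v) ≡ + suc (toℕ w) → v ≡ w
  vertexValue-injective eq = toℕ-injective (suc-injective (ℤ.+-injective eq))

  Kept : State → State → Set
  Kept s s′ = registers s′ chosenReg ≡ registers s chosenReg × registers s′ cursorReg ≡ registers s cursorReg ×
              registers s′ flagReg ≡ registers s flagReg

  step-close-at : ∀ {N p q S y} → Step N {n} p (close S y) q → ∃[ l ] p ≡ at S l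
  step-close-at close     = _ , refl
  step-close-at closeRoot = _ , refl

  module Placing (U : Vertex → Set) (Lab : Vertex → List ℕ → Set) (Stamp : ℕ → Vertex → Set) (N : ℕ)
                 (o : ℕ → Value) (i : ℕ) {w : Vertex} (Uw : U w) where

    -- Serves the root class during filling, a class made earlier in the same visit, and a new
    -- class. In all three the class has no subclass yet, so a vertex may stand directly before its
    -- end.
    place-terminates : ∀ {s f g k D E c S y l q} →
      Registers i s → registers s neighbourReg ≡ vertexValue w → registers s classReg ≡ nodeRef listAt c →
      Memory (heap s) f g o k (D ++ (c , close S y) ∷ E) →
      Consistent f g (λ u → U u × u ≢ w) Lab Stamp (D ++ (c , close S y) ∷ E) →
      (∀ {u} → ¬ U u → entry g u ≡ nil) → Lab w S →
      Path N before D (at S l) → l ≡ top S → Step N (at S l) (close S y) q → Path N q E after →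
      ∃[ s′ ] (B ⊢ place , s ⇓[ 4 ] s′) × Kept s s′ ×
              Tracking U Lab Stamp N o i s′ (suc (length S) + potential (D ++ (c , close S y) ∷ E))
    place-terminates {s} {f} {g} {k} {D} {E} {c} {S} {y} R w≡ c≡ M C off lab ds l≡top st es =
      _ ,
      seq⇓ (insertBefore-item D c≡ w≡ (listMem M))
        (seq⇓ (predecessor-item D c≡ (listMem M₁))
          (seq⇓ (write-entry (positions≡ R) (positionsMem M₁) w≡ refl)
                (write-entry (classes≡ R) (classesMem M₂) w≡ c≡))) ,
      (refl , refl , refl) ,
      record
        { positions   = f [ w ↤ nodeRef listAt k ]
        ; classes     = g [ w ↤ nodeRef listAt c ]
        ; registersOk = R
        ; memory      = memory-classes M₂
        ; path        = path-++⁺ ds (vert l≡top ∷ st ∷ es)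
        ; consistent  = consistent-map (λ { (inj₁ (Uu , _)) → Uu ; (inj₂ refl) → Uw }) decide (λ _ l → l) (λ st → st)
                          (consistent-↭ (↭-sym (shift _ D _))
                            (consistent-add-vert C (λ (_ , w≢w) → w≢w refl) lab (∈-insert D)))
        ; classes-nil = λ ¬Uu → trans (entry-other g (λ { refl → ¬Uu Uw })) (off ¬Uu)
        ; potential≡  = potential-↭ (shift (k , vert w S) D _)
        }
      where
      M₁ : Memory _ f g o (suc k) (D ++ (k , vert w S) ∷ (c , close S y) ∷ E)
      M₁ = memory-list M
      M₂ : Memory _ (f [ w ↤ nodeRef listAt k ]) g o (suc k) (D ++ (k , vert w S) ∷ (c , close S y) ∷ E)
      M₂ = memory-positions M₁
      decide : ∀ {u} → U u → (U u × u ≢ w) ⊎ u ≡ w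
      decide {u} Uu with u Fin.≟ w
      ... | yes u≡w = inj₂ u≡w
      ... | no  u≢w = inj₁ (Uu , u≢w)

  module Visiting (U : Vertex → Set) (U? : ∀ w → Dec (U w)) (Stamp : ℕ → Vertex → Set)
                  (v : Vertex) (¬Uv : ¬ U v) (i : ℕ) (stamp-v : Stamp i v)
                  (stamp : ∀ {j y} → Stamp j y → (y ≡ v × j ≡ i) ⊎ (y ≢ v × j < i)) (o : ℕ → Value) where

    -- The item before the end of the class S either ends the class i ∷ S or ends no class created at time i.
    data Last (S : List ℕ) (l : ℕ) : Token n → Position → Set where
      current : ∀ {k} → i ≤ k → Last S l (close (i ∷ S) v) (at (i ∷ S) k)
      other   : ∀ {t p z} → value t ≡ int z → z ≢ + suc (toℕ v) → l < i → Last S l t p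

    -- The value of an opening item is 0, which is no vertex, and the vertices in the list are
    -- unnumbered and hence not `v`. So the value `v` occurs only at the end of a class created at
    -- time `i`.
    last-item : ∀ {f g V Lab D j t p S l} → (∀ {u} → V u → U u) → Consistent f g V Lab Stamp D → (j , t) ∈ D → Step i p t (at S l) →
                Good i p → top S < i → Last S l t p
    last-item V⇒U C t∈ openRoot      _ top<i = other refl (λ ()) top<i
    last-item V⇒U C t∈ (open′ _ _)   _ top<i = other refl (λ ()) top<i
    last-item V⇒U C t∈ (vert refl)   _ top<i =
      other refl (λ w≡v → ¬Uv (subst U (vertexValue-injective w≡v) (V⇒U (proj₁ (itemOk C t∈))))) top<i
    last-item V⇒U C t∈ (close {S} {y = y}) (_ , l≤k , _) _ with stamp (itemOk C t∈)
    ... | inj₁ (refl , refl) = current l≤k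
    ... | inj₂ (y≢v , l<i)   = other refl (y≢v ∘ vertexValue-injective) l<i

    -- The constant 36 consists of twelve steps and three units of potential: one for the longer
    -- label and two for the brackets of a new class.
    relocate-terminates : ∀ {s f g k D E w j S c y Lab Lab′} →
      Registers i s → registers s chosenReg ≡ vertexValue v →
      registers s neighbourReg ≡ vertexValue w → registers s classReg ≡ nodeRef listAt c →
      Memory (heap s) f g o k (D ++ (j , vert w S) ∷ E) → Path i before (D ++ (j , vert w S) ∷ E) after →
      Consistent f g U Lab Stamp (D ++ (j , vert w S) ∷ E) →
      (∀ {u} → ¬ U u → entry g u ≡ nil) →
      (c , close S y) ∈ D ++ E → top S < i → Lab′ w (i ∷ S) → (∀ {u T} → u ≢ w → Lab u T → Lab′ u T) →
      Terminating relocate s (36 + potential (D ++ (j , vert w S) ∷ E) * 8)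
        (λ s′ φ → Kept s s′ × Tracking U Lab′ Stamp i o i s′ φ)
    relocate-terminates {s} {f} {g} {k} {D} {E} {w} {j} {S} {c} {y} {Lab} {Lab′}
                        R v≡ w≡ c≡ M ds C off c∈ top<i lab labs
      with Uw , _ , w-at , _ ← itemOk C (∈-insert D)
         | D₁ , E₁ , D≡ ← ∈-∃++ c∈
      = split D₁ D≡
          (subst (λ D → Path i before D after) D≡ (path-remove-vert D ds))
          (subst (Consistent f g (λ u → U u × u ≢ w) Lab′ Stamp) D≡
            (consistent-map (λ Uu → Uu) (λ Uu → Uu) (λ (_ , u≢w) → labs u≢w) (λ st → st)
              (consistent-drop-vert (consistent-↭ (shift _ D E) C))))
      where
      open Placing U Lab′ Stamp i o i Uw
      P : ℕ
      P = potential (D ++ (j , vert w S) ∷ E)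
      P≡ : P ≡ suc (length S) + potential (D ++ E)
      P≡ = potential-↭ (shift (j , vert w S) D E)
      Goal : Set
      Goal = Terminating relocate s (36 + P * 8) (λ s′ φ → Kept s s′ × Tracking U Lab′ Stamp i o i s′ φ)
      enough : ∀ t d {P′} → t ≤ 12 → P′ ≡ d + potential (D ++ E) → d ≤ 2 →
               t + (suc (suc (length S)) + P′) * 8 ≤ 36 + P * 8
      enough t d t≤12 refl d≤2 = begin
        t + (suc (suc (length S)) + (d + Q)) * 8  ≤⟨ +-mono-≤ t≤12 (*-monoˡ-≤ 8 (+-monoʳ-≤ (2 + length S) (+-monoˡ-≤ Q d≤2))) ⟩
        12 + (suc (suc (length S)) + (2 + Q)) * 8 ≡⟨ lemma (length S) Q ⟩
        36 + (suc (length S) + Q) * 8             ≡⟨ cong (λ p → 36 + p * 8) (sym P≡) ⟩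
        36 + P * 8                                ∎
        where
        open ≤-Reasoning
        Q : ℕ
        Q = potential (D ++ E)
        lemma : ∀ m Q → 12 + (suc (suc m) + (2 + Q)) * 8 ≡ 36 + (suc m + Q) * 8
        lemma = solve-∀

      split : ∀ D₁ {E₁} → D ++ E ≡ D₁ ++ [ (c , close S y) ] ++ E₁ → Path i before (D₁ ++ (c , close S y) ∷ E₁) after →
              Consistent f g (λ u → U u × u ≢ w) Lab′ Stamp (D₁ ++ (c , close S y) ∷ E₁) → Goal
      split D₁ D≡ ds C with path-++⁻ D₁ ds
      ... | q , ds , st ∷ es with l , refl ← step-close-at st with initLast D₁
      split _ D≡ _ C | _ , () , _ ∷ _ | []
      split _ {E₁} D≡ _ C | _ , dsY , st ∷ es | ys ∷ʳ′ (p , t) with path-++⁻ ys dsY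
      ... | q , ds , st′ ∷ [] =
        finish (last-item proj₁ C′ (∈-insert ys) st′ good top<i) st′
        where
        D≡′ : D ++ E ≡ ys ++ (p , t) ∷ (c , close S y) ∷ E₁
        D≡′ = trans D≡ (∷ʳ-++ ys _ _)
        C′ : Consistent f g (λ u → U u × u ≢ w) Lab′ Stamp (ys ++ (p , t) ∷ (c , close S y) ∷ E₁)
        C′ = subst (Consistent f g (λ u → U u × u ≢ w) Lab′ Stamp) (∷ʳ-++ ys _ _) C
        good : Good i q
        good = path-good ds tt
        M₁ : Memory _ f g o k (ys ++ (p , t) ∷ (c , close S y) ∷ E₁)
        M₁ = subst (Memory _ f g o k) D≡′ (memory-list M)
        s₁ : State
        s₁ = setRegister valueReg (value t) (setRegister itemReg (nodeRef listAt p)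
               (store listAt (dlist k (map node (D ++ E))) (setRegister itemReg (nodeRef listAt j) s)))
        begin⇓ : ∀ {d u s′} → B ⊢ d , s₁ ⇓[ u ] s′ →
                 B ⊢ itemReg := positionsReg ⟨ neighbourReg ⟩ ⨾ removeNode itemReg ⨾
                     predecessor itemReg classReg ⨾ valueOf valueReg itemReg ⨾ d , s ⇓[ 4 + u ] s′
        begin⇓ run =
          seq⇓ (read-entry (positions≡ R) (positionsMem M) w≡ w-at)
            (seq⇓ (remove-item D refl (listMem M))
              (seq⇓ (predecessor-item ys c≡ (listMem M₁))
                (seq⇓ (valueOf-item ys refl (listMem M₁)) run)))
        finish : Last S l t q → Step i q t (at S l) → Goal
        -- No letter exceeds `i`, so `k ≤ i` as well; then `k = i`, and the class is still without
        -- subclasses.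
        finish (current i≤k) st′ =
          let s′ , run , kept , T = place-terminates {s = setRegister classReg (nodeRef listAt p) s₁} {D = ys}
                R w≡ refl M₁ C′ off lab ds (≤-antisym (proj₂ (proj₂ good)) i≤k) st′ (st ∷ es)
          in _ , s′ , _ , begin⇓ (seq⇓ (ifEqual⇓ refl v≡ refl assign⇓) run) ,
             enough 10 0 (m≤n+m 10 2) (cong potential (sym D≡′)) z≤n , kept , T
        finish (other {z = z} value≡ z≢v l<i) st′ =
          let s′ , run , kept , T = place-terminates
                {s = store listAt (dlist (2 + k) (map node D₃))
                       (setRegister classReg (nodeRef listAt k) (store listAt (dlist (suc k) (map node D₂)) s₁))}
                {D = Y ∷ʳ (suc k , open′)} R w≡ refl M₃ C₃ off lab
                (path-++⁺ dsY (open′ l<i ≤-refl ∷ [])) refl close (step-close st ∷ es)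
          in _ , s′ , _ ,
             begin⇓ (seq⇓ (ifUnequal⇓ value≡ v≡ z≢v
               (seq⇓ (insertBefore-item Y c≡ v≡ (listMem M₁′))
                 (seq⇓ (predecessor-item Y c≡ (listMem M₂))
                   (insertBefore-item Y refl (zero≡ R) (listMem M₂))))) run) ,
             enough 12 2 ≤-refl
               (trans (cong potential (∷ʳ-++ Y _ _))
                 (trans (potential-↭ (↭-sym pair)) (cong (λ D → 2 + potential D) (sym D≡)))) ≤-refl , kept , T
          where
          Y D₂ D₃ : List (Item n)
          Y = ys ∷ʳ (p , t)
          D₂ = Y ++ (k , close (i ∷ S) v) ∷ (c , close S y) ∷ E₁
          D₃ = Y ++ (suc k , open′) ∷ (k , close (i ∷ S) v) ∷ (c , close S y) ∷ E₁
          M₁′ : Memory _ f g o k (Y ++ (c , close S y) ∷ E₁)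
          M₁′ = subst (Memory _ f g o k) D≡ (memory-list M)
          M₂ : Memory _ f g o (suc k) D₂
          M₂ = memory-list M₁′
          M₃ : Memory _ f g o (2 + k) (Y ∷ʳ (suc k , open′) ++ (k , close (i ∷ S) v) ∷ (c , close S y) ∷ E₁)
          M₃ = subst (Memory _ f g o (2 + k)) (sym (∷ʳ-++ Y _ _)) (memory-list M₂)
          pair : (suc k , open′) ∷ (k , close (i ∷ S) v) ∷ Y ++ (c , close S y) ∷ E₁ ↭ D₃
          pair = ↭-sym (↭-trans (shift _ Y _) (prep _ (shift _ Y _)))
          C₃ : Consistent f g (λ u → U u × u ≢ w) Lab′ Stamp
                 (Y ∷ʳ (suc k , open′) ++ (k , close (i ∷ S) v) ∷ (c , close S y) ∷ E₁)
          C₃ = subst (Consistent f g (λ u → U u × u ≢ w) Lab′ Stamp) (sym (∷ʳ-++ Y _ _))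
                 (consistent-↭ pair (consistent-add-class C stamp-v))

    module Scanning (Lab₀ Lab₁ : Vertex → List ℕ → Set) (low : ∀ {w S} → Lab₀ w S → top S < i)
                    (extend : ∀ {w S} → U w → w ∈ neighbours v → Lab₀ w S → Lab₁ w (i ∷ S)) where

      -- The labels when the neighbours in ws have not been processed yet.
      LabAt : List Vertex → Vertex → List ℕ → Set
      LabAt ws w S = (w ∈ ws → Lab₀ w S) × (w ∉ ws → Lab₁ w S)

      -- `zs` are the nodes from the cursor on and `ws` their vertices. Since the neighbours are
      -- distinct, a processed one does not recur in `ws`, so its new label is final.
      scan-terminates : ∀ ws {s φ ys zs} → Unique ws → (∀ {w} → w ∈ ws → w ∈ neighbours v) →
        zip (upTo (length (neighbours v))) (map vertexValue (neighbours v)) ≡ ys ++ zs →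
        map proj₂ zs ≡ map vertexValue ws →
        registers s chosenReg ≡ vertexValue v → registers s cursorReg ≡ headRef (suc (toℕ v)) zs →
        registers s flagReg ≡ nil → Tracking U (LabAt ws) Stamp i o i s φ →
        Terminating scan s (4 + length ws * 42 + φ * 8) (Tracking U (LabAt []) Stamp i o i)
      scan-terminates [] {φ = φ} {zs = []} _ _ _ _ v≡ cur≡ flag≡ T =
        _ , _ , φ , whileNil⇓ flag≡ (ifNil⇓ cur≡ assign⇓) (whileNode⇓ (root≡ (registersOk T))) , ≤-refl ,
        record
          { registersOk = registersOk T ; memory = memory T ; path = path T ; consistent = consistent T
          ; classes-nil = classes-nil T ; potential≡ = potential≡ T }
      scan-terminates (w ∷ ws) {s} {φ} {ys} {(j , _) ∷ zs} (w∉ ∷ uniq) ws⊆ nodes≡ vals≡ v≡ cur≡ flag≡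
        (record { positions = f ; classes = g ; fresh = k ; items = D ; registersOk = R ; memory = M ; path = ds
                ; consistent = C ; classes-nil = off ; potential≡ = P≡ })
        with refl ← ∷-injectiveˡ vals≡ = go (U? w)
        where
        nodes-next : zip (upTo (length (neighbours v))) (map vertexValue (neighbours v)) ≡
                     (ys ∷ʳ (j , vertexValue w)) ++ zs
        nodes-next = trans nodes≡ (sym (∷ʳ-++ ys _ zs))
        list≡ : heap s (suc (toℕ v)) ≡ just (dlist (length (neighbours v)) (ys ++ (j , vertexValue w) ∷ zs))
        list≡ = trans (neighbourMem M v) (cong (just ∘ dlist _) nodes≡)
        later : ∀ {u S} → u ≢ w → LabAt (w ∷ ws) u S → LabAt ws u S
        later u≢w (lab₀ , lab₁) =
          lab₀ ∘ there , λ u∉ → lab₁ λ { (here u≡w) → u≢w u≡w ; (there u∈) → u∉ u∈ }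
        s₁ : Value → State
        s₁ c = setRegister classReg c
                 (setRegister cursorReg (headRef (suc (toℕ v)) zs) (setRegister neighbourReg (vertexValue w) s))
        run-with : ∀ {c t u s′ s″} → entry g w ≡ c →
                   B ⊢ ifThenElse (isNil classReg) skip relocate , s₁ c ⇓[ t ] s′ →
                   B ⊢ scan , s′ ⇓[ u ] s″ → B ⊢ scan , s ⇓[ suc (suc (3 + t) + u) ] s″
        run-with c≡ run =
          whileNil⇓ flag≡ (ifNode⇓ cur≡
            (seq⇓ (valueOf⇓ {ys = ys} cur≡ list≡)
              (seq⇓ (successor⇓ {ys = ys} cur≡ list≡)
                (seq⇓ (read-entry (classes≡ R) (classesMem M) refl c≡) run))))
        Goal : Set
        Goal = Terminating scan s (4 + suc (length ws) * 42 + φ * 8) (Tracking U (LabAt []) Stamp i o i)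
        go : Dec (U w) → Goal
        go (no ¬Uw) =
          let u , s′ , φ′ , run , le , T = scan-terminates ws {s = s₁ nil} {ys = ys ∷ʳ _} {zs} uniq (ws⊆ ∘ there)
                nodes-next (∷-injectiveʳ vals≡) v≡ refl flag≡
                (record { registersOk = R ; memory = M ; path = ds
                        ; consistent = consistent-map (λ Uu → Uu) (λ Uu → Uu)
                            (λ Uu → later (λ { refl → ¬Uw Uu })) (λ st → st) C
                        ; classes-nil = off ; potential≡ = P≡ })
          in _ , s′ , φ′ , run-with (off ¬Uw) (ifNil⇓ refl skip⇓) run , enough u φ′ le , T
          where
          enough : ∀ u φ′ → u + φ′ * 8 ≤ 4 + length ws * 42 + φ * 8 →
                   7 + u + φ′ * 8 ≤ 4 + suc (length ws) * 42 + φ * 8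
          enough u φ′ le = begin
            7 + u + φ′ * 8                          ≡⟨ +-assoc 7 u _ ⟩
            7 + (u + φ′ * 8)                        ≤⟨ +-mono-≤ (m≤m+n 7 35) le ⟩
            42 + (4 + length ws * 42 + φ * 8)       ≡⟨ lemma (length ws) φ ⟩
            4 + suc (length ws) * 42 + φ * 8        ∎
            where
            open ≤-Reasoning
            lemma : ∀ l p → 42 + (4 + l * 42 + p * 8) ≡ 4 + suc l * 42 + p * 8
            lemma = solve-∀
        go (yes Uw) with _ , S , w∈ ← covers C Uw
          with _ , (lab₀ , _) , _ , c , y , c∈ , class≡ ← itemOk C w∈
             | D , E , refl ← ∈-∃++ w∈ =
          let r , s′ , φ₁ , run₁ , le₁ , (v≡′ , cur≡′ , flag≡′) , T₁ =
                relocate-terminates {s = s₁ (nodeRef listAt c)} {Lab′ = LabAt ws} R v≡ refl refl M ds C off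
                  (still c∈) (low (lab₀ (here refl)))
                  ((λ w∈ws → ⊥-elim (All¬⇒¬Any w∉ w∈ws)) ,
                   λ _ → extend Uw (ws⊆ (here refl)) (lab₀ (here refl))) later
              u , s″ , φ₂ , run₂ , le₂ , T₂ = scan-terminates ws {ys = ys ∷ʳ _} {zs} uniq (ws⊆ ∘ there)
                nodes-next (∷-injectiveʳ vals≡) (trans v≡′ v≡) cur≡′ (trans flag≡′ flag≡) T₁
          in _ , s″ , φ₂ , run-with class≡ (ifNode⇓ refl run₁) run₂ ,
             enough r u φ₁ φ₂ (subst (λ p → r + φ₁ * 8 ≤ 36 + p * 8) P≡ le₁) le₂ , T₂
          where
          still : ∀ {D E : List (Item n)} {j c w S T y} → (c , close S y) ∈ D ++ (j , vert w T) ∷ E →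
                  (c , close S y) ∈ D ++ E
          still {D} c∈ with ∈-++⁻ D c∈
          ... | inj₁ c∈D         = ∈-++⁺ˡ c∈D
          ... | inj₂ (there c∈E) = ∈-++⁺ʳ D c∈E
          enough : ∀ r u φ₁ φ₂ → r + φ₁ * 8 ≤ 36 + φ * 8 → u + φ₂ * 8 ≤ 4 + length ws * 42 + φ₁ * 8 →
                   6 + r + u + φ₂ * 8 ≤ 4 + suc (length ws) * 42 + φ * 8
          enough r u φ₁ φ₂ le₁ le₂ = begin
            6 + r + u + φ₂ * 8                             ≡⟨ +-assoc (6 + r) u _ ⟩
            6 + r + (u + φ₂ * 8)                           ≤⟨ +-monoʳ-≤ (6 + r) le₂ ⟩
            6 + r + (4 + length ws * 42 + φ₁ * 8)          ≡⟨ lemma₁ r (length ws) φ₁ ⟩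
            10 + length ws * 42 + (r + φ₁ * 8)             ≤⟨ +-monoʳ-≤ (10 + length ws * 42) le₁ ⟩
            10 + length ws * 42 + (36 + φ * 8)             ≡⟨ lemma₂ (length ws) φ ⟩
            4 + suc (length ws) * 42 + φ * 8               ∎
            where
            open ≤-Reasoning
            lemma₁ : ∀ r l p → 6 + r + (4 + l * 42 + p * 8) ≡ 10 + l * 42 + (r + p * 8)
            lemma₁ = solve-∀
            lemma₂ : ∀ l p → 10 + l * 42 + (36 + p * 8) ≡ 4 + suc l * 42 + p * 8
            lemma₂ = solve-∀

  zip-values : ∀ (ids : List ℕ) (vs : List Value) → length ids ≡ length vs → map proj₂ (zip ids vs) ≡ vs
  zip-values []        []       _  = refl
  zip-values (_ ∷ ids) (v ∷ vs) eq = cong (v ∷_) (zip-values ids vs (suc-injective eq))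

  -- Labels, marks and listed vertices are abstract, before and after the visit, so that the first
  -- visit fits too: there the word of the source in the list is not its label. `Stamp` already
  -- admits `v`, the mark of the classes to be made.
  visit-terminates : ∀ {U U₀ Stamp Stamp₀ Lab Lab₀ Lab₁ v i o s f g k D E j S} →
    (∀ w → Dec (U w)) → (∀ {w} → U₀ w → w ≢ v → U w) → (∀ {w} → U w → U₀ w) → ¬ U v →
    Stamp (suc i) v → (∀ {j y} → Stamp j y → (y ≡ v × j ≡ suc i) ⊎ (y ≢ v × j < suc i)) →
    (∀ {j y} → Stamp₀ j y → Stamp j y) →
    (∀ {w S} → U w → Lab w S → Lab₀ w S) → (∀ {w S} → Lab₀ w S → top S < suc i) →
    (∀ {w S} → U w → w ∈ neighbours v → Lab₀ w S → Lab₁ w (suc i ∷ S)) →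
    (∀ {w S} → U w → w ∉ neighbours v → Lab₀ w S → Lab₁ w S) →
    i < n → Registers i s → registers s chosenReg ≡ vertexValue v →
    Memory (heap s) f g o k (D ++ (j , vert v S) ∷ E) → Path i before (D ++ (j , vert v S) ∷ E) after →
    Consistent f g U₀ Lab Stamp₀ (D ++ (j , vert v S) ∷ E) → (∀ {w} → ¬ U₀ w → entry g w ≡ nil) →
    Terminating visit s (12 + length (neighbours v) * 42 + potential (D ++ E) * 8)
      (Tracking U Lab₁ Stamp (suc i) (o [ suc i ↦ vertexValue v ]) (suc i))
  visit-terminates {U} {U₀} {Stamp} {Stamp₀} {Lab} {Lab₀} {Lab₁} {v} {i} {o} {s} {f} {g} {k} {D} {E} {j} {S}
                   U? U₀⇒U U⇒U₀ ¬Uv stamp-v stamp Stamp₀⇒Stamp Lab⇒Lab₀ low extend keep i<n R v≡ M ds C off =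
    let _ , _ , v-at , _ = itemOk C (∈-insert D)
        u , s′ , φ , run , le , T = scan-terminates (neighbours v)
          {s = setRegister cursorReg (headRef (suc (toℕ v)) (zip (upTo (length (neighbours v))) (map vertexValue (neighbours v))))
                 (setRegister cursorReg (listRef (suc (toℕ v)))
                   (store classesAt (array n (g [ v ↤ nil ]))
                     (setRegister flagReg nil
                       (store listAt (dlist k (map node (D ++ E)))
                         (setRegister itemReg (nodeRef listAt j)
                           (store outputAt (array n (o [ suc i ↦ vertexValue v ]))
                             (setRegister counterReg (int (+ suc i)) s)))))))}
          {ys = []} (unique v) (λ w∈ → w∈) refl
          (zip-values (upTo (length (neighbours v))) (map vertexValue (neighbours v))
            (trans (length-upTo (length (neighbours v))) (sym (length-map vertexValue (neighbours v)))))
          v≡ refl refl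
          (record
            { registersOk = R′
            ; memory      = M₃
            ; path        = path-mono (n≤1+n i) (path-remove-vert D ds)
            ; consistent  = consistent-map (λ (U₀w , w≢v) → U₀⇒U U₀w w≢v) (λ Uw → U⇒U₀ Uw , λ { refl → ¬Uv Uw })
                              (λ (U₀w , w≢v) lab → let Uw = U₀⇒U U₀w w≢v ; lab₀ = Lab⇒Lab₀ Uw lab in
                                 (λ _ → lab₀) , λ w∉ → keep Uw w∉ lab₀) Stamp₀⇒Stamp
                              (drop-class-entry (consistent-drop-vert (consistent-↭ (shift _ D E) C)))
            ; classes-nil = unnumbered
            ; potential≡  = refl })
    in _ , s′ , φ ,
       seq⇓ (increment⇓ (counter≡ R) (≤-trans i<n (m≤m⊔n n _)))
         (seq⇓ (write-output v≡)
           (seq⇓ (read-entry (positions≡ R) (positionsMem M₁) v≡ v-at)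
             (seq⇓ (remove-item D refl (listMem M₁))
               (seq⇓ nil⇓
                 (seq⇓ (write-entry (classes≡ R) (classesMem M₂) v≡ refl)
                   (seq⇓ (read-entry (adjacency≡ R) (adjacencyMem M₃) v≡ refl)
                     (seq⇓ (firstOf⇓ refl (neighbourMem M₃ v)) run))))))) ,
       ≤-trans (≤-reflexive (+-assoc 8 u _)) (+-monoʳ-≤ 8 le) ,
       record
         { registersOk = registersOk T ; memory = memory T ; path = path T
         ; consistent = consistent-map (λ Uw → Uw) (λ Uw → Uw) (λ _ (_ , lab₁) → lab₁ λ ()) (λ st → st) (consistent T)
         ; classes-nil = classes-nil T ; potential≡ = potential≡ T }
    where
    open Visiting U U? Stamp v ¬Uv (suc i) stamp-v stamp (o [ suc i ↦ vertexValue v ])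
    open Scanning Lab₀ Lab₁ low extend
    R′ : Registers (suc i) (setRegister counterReg (int (+ suc i)) s)
    R′ = record
      { adjacency≡ = adjacency≡ R ; size≡ = size≡ R ; root≡ = root≡ R ; positions≡ = positions≡ R
      ; classes≡ = classes≡ R ; output≡ = output≡ R ; counter≡ = refl ; zero≡ = zero≡ R }
    M₁ : Memory _ f g (o [ suc i ↦ vertexValue v ]) k (D ++ (j , vert v S) ∷ E)
    M₁ = memory-output M
    M₂ : Memory _ f g (o [ suc i ↦ vertexValue v ]) k (D ++ E)
    M₂ = memory-list M₁
    M₃ : Memory _ f (g [ v ↤ nil ]) (o [ suc i ↦ vertexValue v ]) k (D ++ E)
    M₃ = memory-classes M₂
    write-output : ∀ {val} → registers s chosenReg ≡ val →
      B ⊢ outputReg ⟨ counterReg ⟩:= chosenReg , setRegister counterReg (int (+ suc i)) s ⇓[ 1 ]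
        store outputAt (array n (o [ suc i ↦ val ])) (setRegister counterReg (int (+ suc i)) s)
    write-output refl = write⇓ (output≡ R) (outputMem M) refl (s≤s z≤n) i<n
    drop-class-entry : ∀ {D} → Consistent f g (λ w → U₀ w × w ≢ v) Lab Stamp₀ D →
                       Consistent f (g [ v ↤ nil ]) (λ w → U₀ w × w ≢ v) Lab Stamp₀ D
    drop-class-entry {D} C = record
      { itemOk = λ {t} t∈ → item t (itemOk C t∈) ; unique-vertices = unique-vertices C ; covers = covers C }
      where
      item : ∀ t → ItemOk f g (λ w → U₀ w × w ≢ v) Lab Stamp₀ D t →
             ItemOk f (g [ v ↤ nil ]) (λ w → U₀ w × w ≢ v) Lab Stamp₀ D t
      item (_ , open′)    _ = tt
      item (_ , vert _ _) ((U₀w , w≢v) , l , pos , i , y , c∈ , cls) =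
        (U₀w , w≢v) , l , pos , i , y , c∈ , trans (entry-other g w≢v) cls
      item (_ , close [] _)      j≡1 = j≡1
      item (_ , close (_ ∷ _) _) st  = st
    unnumbered : ∀ {w} → ¬ U w → entry (g [ v ↤ nil ]) w ≡ nil
    unnumbered {w} ¬Uw with w Fin.≟ v
    ... | yes refl = entry-same g v
    ... | no  w≢v  = trans (entry-other g w≢v) (off λ U₀w → ¬Uw (U₀⇒U U₀w w≢v))

-- Counting vertices and directed edges.

unique-⊆-length : {X : Set} {xs ys : List X} → Unique xs → (∀ {x} → x ∈ xs → x ∈ ys) → length xs ≤ length ys
unique-⊆-length [] _ = z≤n
unique-⊆-length {xs = x ∷ xs} (x∉ ∷ uniq) ⊆ys with as , bs , refl ← ∈-∃++ (⊆ys (here refl)) = begin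
  suc (length xs)              ≤⟨ s≤s (unique-⊆-length uniq rest) ⟩
  suc (length (as ++ bs))      ≡⟨ cong suc (length-++ as) ⟩
  suc (length as + length bs)  ≡⟨ sym (+-suc (length as) (length bs)) ⟩
  length as + suc (length bs)  ≡⟨ sym (length-++ as) ⟩
  length (as ++ x ∷ bs)        ∎
  where
  open ≤-Reasoning
  rest : ∀ {y} → y ∈ xs → y ∈ as ++ bs
  rest y∈ with ∈-++⁻ as (⊆ys (there y∈))
  ... | inj₁ y∈as         = ∈-++⁺ˡ y∈as
  ... | inj₂ (here refl)  = ⊥-elim (All¬⇒¬Any x∉ y∈)
  ... | inj₂ (there y∈bs) = ∈-++⁺ʳ as y∈bs

∈-∷ʳ⁺ˡ : {X : Set} {m : ℕ} {x y : X} {σ : Vec X m} → x ∈ᵛ σ → x ∈ᵛ σ ∷ʳᵛ y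
∈-∷ʳ⁺ˡ (hereᵛ refl) = hereᵛ refl
∈-∷ʳ⁺ˡ (thereᵛ x∈)  = thereᵛ (∈-∷ʳ⁺ˡ x∈)

∈-∷ʳ⁺ʳ : {X : Set} {m : ℕ} {y : X} (σ : Vec X m) → y ∈ᵛ σ ∷ʳᵛ y
∈-∷ʳ⁺ʳ []ᵛ      = hereᵛ refl
∈-∷ʳ⁺ʳ (_ ∷ᵛ σ) = thereᵛ (∈-∷ʳ⁺ʳ σ)

∈-∷ʳ⁻ : {X : Set} {m : ℕ} {x y : X} (σ : Vec X m) → x ∈ᵛ σ ∷ʳᵛ y → x ∈ᵛ σ ⊎ x ≡ y
∈-∷ʳ⁻ []ᵛ      (hereᵛ refl) = inj₂ refl
∈-∷ʳ⁻ (_ ∷ᵛ σ) (hereᵛ refl) = inj₁ (hereᵛ refl)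
∈-∷ʳ⁻ (_ ∷ᵛ σ) (thereᵛ x∈) with ∈-∷ʳ⁻ σ x∈
... | inj₁ x∈σ = inj₁ (thereᵛ x∈σ)
... | inj₂ x≡y = inj₂ x≡y

lookup-∷ʳ : {X : Set} {m : ℕ} (σ : Vec X m) (y : X) (P : ℕ → X → Set) →
            (∀ (q : Fin m) → P (toℕ q) (lookup σ q)) → P m y → ∀ q → P (toℕ q) (lookup (σ ∷ʳᵛ y) q)
lookup-∷ʳ []ᵛ      y P Pσ Py Fin.zero    = Py
lookup-∷ʳ (_ ∷ᵛ σ) y P Pσ Py Fin.zero    = Pσ Fin.zero
lookup-∷ʳ (_ ∷ᵛ σ) y P Pσ Py (Fin.suc q) = lookup-∷ʳ σ y (P ∘ suc) (Pσ ∘ Fin.suc) Py q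

-- Pigeonhole. The vertex obtained guarantees that the search has something to find.
missing : ∀ {n i} → i < n → (σ : Vec (Fin n) i) → ∃[ w ] w ∉ᵛ σ
missing {n} {i} i<n σ = ¬∀⟶∃¬ n (_∈ᵛ σ) (_∈? σ) λ all → <⇒≱ i<n (begin
  n                  ≡⟨ sym (length-tabulate {n = n} (λ w → w)) ⟩
  length (allFin n)  ≤⟨ unique-⊆-length (allFin⁺ n) (λ _ → ∈-toList⁺ (all _)) ⟩
  length (toList σ)  ≡⟨ length-toList σ ⟩
  i                  ∎)
  where
  open ≤-Reasoning
  open VecDec Fin._≟_ using (_∈?_)

module Edges (G : Graph) where
  open Graph G

  -- Every directed edge is an entry of `edges` or the reverse of one, according to the order of its
  -- ends.
  directed-bound : ∀ {P : List (Vertex × Vertex)} → Unique P → (∀ {e} → e ∈ P → adjacent (proj₁ e) (proj₂ e) ≡ true) →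
                   length P ≤ 2 * ∣E∣
  directed-bound {P} uniq adj = begin
    length P                          ≤⟨ unique-⊆-length uniq oriented ⟩
    length (edges ++ map swap edges)  ≡⟨ length-++ edges ⟩
    ∣E∣ + length (map swap edges)     ≡⟨ cong (λ l → ∣E∣ + l) (length-map swap edges) ⟩
    ∣E∣ + ∣E∣                         ≡⟨ cong (λ l → ∣E∣ + l) (sym (+-identityʳ ∣E∣)) ⟩
    2 * ∣E∣                           ∎
    where
    open ≤-Reasoning
    ascending : ∀ {v w} → v Fin.< w → adjacent v w ≡ true → (v , w) ∈ edges
    ascending {v} {w} v<w vw = ∈-filter⁺ _ (∈-cartesianProduct⁺ (∈-allFin v) (∈-allFin w)) (v<w , subst Bool.T (sym vw) tt)
    oriented : ∀ {e} → e ∈ P → e ∈ edges ++ map swap edges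
    oriented {v , w} e∈ with Fin.<-cmp v w
    ... | tri< v<w _ _ = ∈-++⁺ˡ (ascending v<w (adj e∈))
    ... | tri> _ _ w<v = ∈-++⁺ʳ edges (∈-map⁺ swap (ascending w<v (trans (symmetric w v) (adj e∈))))
    ... | tri≈ _ refl _ with () ← trans (sym (loopless v)) (adj e∈)

-- The whole program and its initialisation.

fillBody fill setup program : Command
fillBody =
  increment counterReg ⨾
  neighbourReg := counterReg ⨾
  classReg := rootReg ⨾
  place
fill = while (counterReg lessThan sizeReg) fillBody
setup =
  -- `flagReg` is nil in the input and provides the initial entries of the arrays.
  newArray positionsReg sizeReg flagReg ⨾
  newArray classesReg sizeReg flagReg ⨾
  newArray outputReg sizeReg flagReg ⨾
  newList classReg ⨾
  zeroReg :=const (+ 0) ⨾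
  insertLast classReg zeroReg ⨾
  insertLast classReg sourceReg ⨾
  lastOf rootReg classReg ⨾
  counterReg :=const (+ 0) ⨾
  chosenReg := sourceReg ⨾
  fill ⨾
  counterReg :=const (+ 0)
program =
  setup ⨾
  visit ⨾
  while (counterReg lessThan sizeReg) (find ⨾ visit) ⨾
  adjacencyReg := outputReg

module Running (G : Graph) (A : AdjacencyLists G) where
  open Graph G renaming (∣V∣ to n)
  open AdjacencyLists A
  open Layout G A
  open Search G A
  open Visits G A
  open Tracking

  Filled : ℕ → Vertex → Set
  Filled i w = toℕ w < i

  Root : Vertex → List ℕ → Set
  Root _ S = S ≡ []

  None : ℕ → Vertex → Set
  None _ _ = ⊥

  -- Sixteen per vertex: eight steps for a round, and one unit for a vertex with empty label.
  fill-terminates : ∀ m i {s φ o} → i + m ≡ n → Tracking (Filled i) Root None 0 o i s φ →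
    registers s chosenReg ≡ vertexValue source →
    Terminating fill s (1 + m * 16 + φ * 8)
      (λ s′ φ′ → Tracking (Filled n) Root None 0 o n s′ φ′ × registers s′ chosenReg ≡ vertexValue source)
  fill-terminates zero i {s} {φ} i+0≡n T v≡ with refl ← trans (sym (+-identityʳ i)) i+0≡n =
    1 , s , φ , whileNotLess⇓ (counter≡ (registersOk T)) (size≡ (registersOk T)) (<-irrefl refl) , ≤-refl , T , v≡
  fill-terminates (suc m) i {s} {φ} {o} i+m≡n
    (record { positions = f ; classes = g ; fresh = k ; items = D ; registersOk = R ; memory = M ; path = ds
            ; consistent = C ; classes-nil = off ; potential≡ = P≡ }) v≡
    with ys , y , l , refl , ds ← root-last ds C
    -- With `N = 0` the position before the end of the root is `at [] 0`, so a vertex may be placed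
    -- there.
    with z≤n ← proj₂ (proj₂ (path-good ds tt)) =
    let w = fromℕ< i<n
        w≡ : int (+ suc i) ≡ vertexValue w
        w≡ = cong (λ j → int (+ suc j)) (sym (toℕ-fromℕ< i<n))
        s₁ , run₁ , (v≡′ , _ , _) , T₁ = Placing.place-terminates (Filled (suc i)) Root None 0 o (suc i) {w}
          (s≤s (≤-reflexive (toℕ-fromℕ< i<n)))
          {s = setRegister classReg (registers s rootReg) (setRegister neighbourReg (int (+ suc i))
                 (setRegister counterReg (int (+ suc i)) s))}
          {D = ys} {E = []}
          (record { adjacency≡ = adjacency≡ R ; size≡ = size≡ R ; root≡ = root≡ R ; positions≡ = positions≡ R
                  ; classes≡ = classes≡ R ; output≡ = output≡ R ; counter≡ = refl ; zero≡ = zero≡ R })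
          w≡ (root≡ R) M
          (consistent-map (λ w<i → m<n⇒m<1+n w<i , λ { refl → <⇒≢ w<i (toℕ-fromℕ< i<n) })
            (λ (u<1+i , u≢w) → ≤∧≢⇒< (s≤s⁻¹ u<1+i) (λ u≡i → u≢w (toℕ-injective (trans u≡i (sym (toℕ-fromℕ< i<n))))))
            (λ _ S≡ → S≡) (λ ()) C)
          (λ u≮1+i → off (λ u<i → u≮1+i (m<n⇒m<1+n u<i))) refl ds refl closeRoot []
        u , s₂ , φ₂ , run₂ , le , Q = fill-terminates m (suc i) {s = s₁} (trans (sym (+-suc i m)) i+m≡n) T₁ (trans v≡′ v≡)
    in _ , s₂ , φ₂ ,
       whileLess⇓ (counter≡ R) (size≡ R) i<n
         (seq⇓ (increment⇓ (counter≡ R) (≤-trans i<n (m≤m⊔n n _))) (seq⇓ assign⇓ (seq⇓ assign⇓ run₁))) run₂ ,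
       (begin
         8 + u + φ₂ * 8                  ≡⟨ +-assoc 8 u _ ⟩
         8 + (u + φ₂ * 8)                ≤⟨ +-monoʳ-≤ 8 le ⟩
         8 + (1 + m * 16 + suc (potential (ys ∷ʳ (1 , close [] y))) * 8)  ≡⟨ cong (λ p → 8 + (1 + m * 16 + suc p * 8)) P≡ ⟩
         8 + (1 + m * 16 + suc φ * 8)    ≡⟨ lemma m φ ⟩
         1 + suc m * 16 + φ * 8          ∎) , Q
    where
    open ≤-Reasoning
    lemma : ∀ m p → 8 + (1 + m * 16 + suc p * 8) ≡ 1 + suc m * 16 + p * 8
    lemma = solve-∀
    i<n : i < n
    i<n = subst (suc i ≤_) i+m≡n (≤-trans (s≤s (m≤m+n i m)) (≤-reflexive (sym (+-suc i m))))

  input-neighbours : ∀ v → heap (input A) (suc (toℕ v)) ≡ just (neighbourList A v)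
  input-neighbours v with toℕ v <? n
  ... | yes v<n = cong (just ∘ neighbourList A) (fromℕ<-toℕ v v<n)
  ... | no  v≮n = ⊥-elim (v≮n (toℕ<n v))

  setup-terminates : Terminating setup (input A) (44 + n * 19)
    (λ s φ → Tracking (Filled n) Root None 0 (λ _ → nil) 0 s φ × registers s chosenReg ≡ vertexValue source)
  setup-terminates =
    let t , s′ , φ , run , le , T , v≡ = fill-terminates n 0 {s = s₅} refl filled refl
    in _ , setRegister counterReg (int (+ 0)) s′ , φ ,
       seq⇓ (newArray⇓ refl) (seq⇓ (newArray⇓ refl) (seq⇓ (newArray⇓ refl) (seq⇓ newList⇓
         (seq⇓ (const⇓ z≤n) (seq⇓ (insertLast⇓ refl (listMem M₀)) (seq⇓ (insertLast⇓ refl (listMem M₁))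
           (seq⇓ (lastOf⇓ refl (listMem M₂)) (seq⇓ (const⇓ z≤n) (seq⇓ assign⇓ (seq⇓ run (const⇓ z≤n))))))))))) ,
       enough t φ le ,
       (let R = registersOk T in record
         { registersOk = record
             { adjacency≡ = adjacency≡ R ; size≡ = size≡ R ; root≡ = root≡ R ; positions≡ = positions≡ R
             ; classes≡ = classes≡ R ; output≡ = output≡ R ; counter≡ = refl ; zero≡ = zero≡ R }
         ; memory = memory T ; path = path T ; consistent = consistent T
         ; classes-nil = classes-nil T ; potential≡ = potential≡ T }) , v≡
    where
    blank : Object
    blank = array n (λ _ → nil)
    s₀ s₁ s₂ s₃ s₄ s₅ : State
    s₀ = setRegister outputReg (arrayRef outputAt) (allocate blank
           (setRegister classesReg (arrayRef classesAt) (allocate blank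
             (setRegister positionsReg (arrayRef positionsAt) (allocate blank (input A))))))
    s₁ = setRegister zeroReg (int (+ 0)) (setRegister classReg (listRef listAt) (allocate (dlist 0 []) s₀))
    items₁ items₂ : List (Item n)
    items₁ = [ (0 , open′) ]
    items₂ = (0 , open′) ∷ (1 , close [] source) ∷ []
    s₂ = store listAt (dlist 1 (map node items₁)) s₁
    s₃ = store listAt (dlist 2 (map node items₂)) s₂
    s₄ = setRegister rootReg (nodeRef listAt 1) s₃
    s₅ = setRegister chosenReg (vertexValue source) (setRegister counterReg (int (+ 0)) s₄)
    M₀ : Memory (heap s₁) (λ _ → nil) (λ _ → nil) (λ _ → nil) 0 []
    M₀ = record
      { adjacencyMem = refl
      ; neighbourMem = λ v →
          trans (↦-other (heap s₀) (toℕ≢n+ v 3)) (trans (↦-other h₂ (toℕ≢n+ v 2))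
            (trans (↦-other h₁ (toℕ≢n+ v 1)) (trans (↦-other (heap (input A)) (toℕ≢n+ v 0)) (input-neighbours v))))
      ; positionsMem = trans (↦-other (heap s₀) {positionsAt} (<⇒≢ (m≤n+m _ 2)))
                         (trans (↦-other h₂ {positionsAt} (<⇒≢ (m≤n+m _ 1)))
                           (trans (↦-other h₁ {positionsAt} (<⇒≢ ≤-refl)) (↦-same (heap (input A)) positionsAt)))
      ; classesMem   = trans (↦-other (heap s₀) {classesAt} (<⇒≢ (m≤n+m _ 1)))
                         (trans (↦-other h₂ {classesAt} (<⇒≢ ≤-refl)) (↦-same h₁ classesAt))
      ; outputMem    = trans (↦-other (heap s₀) {outputAt} (<⇒≢ ≤-refl)) (↦-same h₂ outputAt)
      ; listMem      = ↦-same (heap s₀) listAt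
      }
      where
      h₁ h₂ : ℕ → _
      h₁ = heap (input A) [ positionsAt ↦ just blank ]
      h₂ = h₁ [ classesAt ↦ just blank ]
    M₁ : Memory (heap s₂) (λ _ → nil) (λ _ → nil) (λ _ → nil) 1 items₁
    M₁ = memory-list M₀
    M₂ : Memory (heap s₃) (λ _ → nil) (λ _ → nil) (λ _ → nil) 2 items₂
    M₂ = memory-list M₁
    filled : Tracking (Filled 0) Root None 0 (λ _ → nil) 0 s₅ 2
    filled = record
      { registersOk = record
          { adjacency≡ = refl ; size≡ = refl ; root≡ = refl ; positions≡ = refl
          ; classes≡ = refl ; output≡ = refl ; counter≡ = refl ; zero≡ = refl }
      ; memory      = M₂
      ; path        = openRoot ∷ closeRoot ∷ []
      ; consistent  = record
          { itemOk  = λ { (here refl) → tt ; (there (here refl)) → refl }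
          ; unique-vertices = []
          ; covers  = λ ()
          }
      ; classes-nil = λ _ → refl
      ; potential≡  = refl
      }
    enough : ∀ t φ → t + φ * 8 ≤ 1 + n * 16 + 2 * 8 →
             suc n + (suc n + (suc n + (7 + (t + 1)))) + φ * 8 ≤ 44 + n * 19
    enough t φ le = begin
      suc n + (suc n + (suc n + (7 + (t + 1)))) + φ * 8 ≡⟨ lemma₁ n t φ ⟩
      11 + n * 3 + (t + φ * 8)                          ≤⟨ +-monoʳ-≤ (11 + n * 3) le ⟩
      11 + n * 3 + (1 + n * 16 + 2 * 8)                 ≡⟨ lemma₂ n ⟩
      28 + n * 19                                       ≤⟨ +-monoˡ-≤ (n * 19) (m≤m+n 28 16) ⟩
      44 + n * 19                                       ∎
      where
      open ≤-Reasoning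
      lemma₁ : ∀ n t p → suc n + (suc n + (suc n + (7 + (t + 1)))) + p * 8 ≡ 11 + n * 3 + (t + p * 8)
      lemma₁ = solve-∀
      lemma₂ : ∀ n → 11 + n * 3 + (1 + n * 16 + 2 * 8) ≡ 28 + n * 19
      lemma₂ = solve-∀

-- Each phase starts with the potential that the previous one left, so the potentials cancel; `d` is
-- the degree of the source and `r` the budget for all other degrees. The fixed 58 steps are charged
-- to the vertices, of which there is at least one; the resulting 93 and 84 are rounded up to 100.
total-time : ∀ {n e} → 0 < n → ∀ t₀ t₁ t₂ φ₀ φ₁ φ₂ d r → 2 * e ≡ d + r → t₀ + φ₀ * 8 ≤ 44 + n * 19 →
         t₁ + φ₁ * 8 ≤ 12 + d * 42 + φ₀ * 8 → t₂ + φ₂ * 8 ≤ 1 + (n ∸ 1) * 16 + r * 42 + φ₁ * 8 →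
         t₀ + (t₁ + (t₂ + 1)) ≤ (n + e) * 100
total-time {n} {e} n>0 t₀ t₁ t₂ φ₀ φ₁ φ₂ d r r≡ le₀ le₁ le₂ = begin
  t₀ + (t₁ + (t₂ + 1))                                       ≡⟨ lemma₀ t₀ t₁ t₂ ⟩
  1 + t₀ + t₁ + t₂                                           ≤⟨ +-monoʳ-≤ (1 + t₀ + t₁) (≤-trans (m≤m+n t₂ (φ₂ * 8)) le₂) ⟩
  1 + t₀ + t₁ + (1 + (n ∸ 1) * 16 + r * 42 + φ₁ * 8)         ≤⟨ +-monoʳ-≤ (1 + t₀ + t₁) (+-monoˡ-≤ (φ₁ * 8) (+-monoˡ-≤ (r * 42)
                                                                  (s≤s (*-monoˡ-≤ 16 (m∸n≤m n 1))))) ⟩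
  1 + t₀ + t₁ + (1 + n * 16 + r * 42 + φ₁ * 8)               ≡⟨ lemma₁ t₀ t₁ n r φ₁ ⟩
  2 + t₀ + n * 16 + r * 42 + (t₁ + φ₁ * 8)                   ≤⟨ +-monoʳ-≤ (2 + t₀ + n * 16 + r * 42) le₁ ⟩
  2 + t₀ + n * 16 + r * 42 + (12 + d * 42 + φ₀ * 8)          ≡⟨ lemma₂ t₀ n r d φ₀ ⟩
  14 + n * 16 + (d + r) * 42 + (t₀ + φ₀ * 8)                 ≤⟨ +-monoʳ-≤ (14 + n * 16 + (d + r) * 42) le₀ ⟩
  14 + n * 16 + (d + r) * 42 + (44 + n * 19)                 ≡⟨ cong (λ x → 14 + n * 16 + x * 42 + (44 + n * 19)) (sym r≡) ⟩
  14 + n * 16 + (2 * e) * 42 + (44 + n * 19)               ≡⟨ lemma₃ n e ⟩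
  58 + (n * 35 + e * 84)                                   ≤⟨ +-mono-≤ (*-monoˡ-≤ 58 n>0)
                                                                  (m≤m+n (n * 35 + e * 84) (n * 7 + e * 16)) ⟩
  n * 58 + (n * 35 + e * 84 + (n * 7 + e * 16))          ≡⟨ lemma₄ n e ⟩
  (n + e) * 100                                            ∎
  where
  open ≤-Reasoning
  lemma₀ : ∀ a b c → a + (b + (c + 1)) ≡ 1 + a + b + c
  lemma₀ = solve-∀
  lemma₁ : ∀ a b n r p → 1 + a + b + (1 + n * 16 + r * 42 + p * 8) ≡ 2 + a + n * 16 + r * 42 + (b + p * 8)
  lemma₁ = solve-∀
  lemma₂ : ∀ a n r d p → 2 + a + n * 16 + r * 42 + (12 + d * 42 + p * 8) ≡
                         14 + n * 16 + (d + r) * 42 + (a + p * 8)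
  lemma₂ = solve-∀
  lemma₃ : ∀ n e → 14 + n * 16 + (2 * e) * 42 + (44 + n * 19) ≡ 58 + (n * 35 + e * 84)
  lemma₃ = solve-∀
  lemma₄ : ∀ n e → n * 58 + (n * 35 + e * 84 + (n * 7 + e * 16)) ≡ (n + e) * 100
  lemma₄ = solve-∀

-- Agreement with the LexUP procedure, and the total time.

module Correctness (G : Graph) (A : AdjacencyLists G) where
  open Graph G renaming (∣V∣ to n)
  open AdjacencyLists A
  open Layout G A
  open Search G A
  open Visits G A
  open Running G A
  open Edges G
  open LexUP G hiding (IsLexUPOrdering)
  open VecDec (Fin._≟_ {n}) using (_∈?_)

  Labels : ℕ → Labelling → Vertex → List ℕ → Set
  Labels i label w S = label w ≡ word S × top S ≤ i

  Stamps : ∀ {i} → Vec Vertex i → ℕ → Vertex → Set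
  Stamps {i} σ j y = y ∈ᵛ σ × j ≤ i

  -- `processed` collects the directed edges that leave numbered vertices, and `r` is what remains
  -- of `2 * ∣E∣`: the budget for the degrees of the vertices to come.
  record Progress (i r : ℕ) (s : State) (φ : ℕ) : Set where
    field
      {order}     : Vec Vertex i
      {labelling} : Labelling
      {output}    : ℕ → Value
      {processed} : List (Vertex × Vertex)
      run         : Run i order labelling
      tracking    : Tracking (_∉ᵛ order) (Labels i labelling) (Stamps order) i output i s φ
      output≡     : ∀ q → output (suc (toℕ q)) ≡ vertexValue (lookup order q)
      unique-processed : Unique processed
      adjacent-processed : ∀ {e} → e ∈ processed → proj₁ e ∈ᵛ order × adjacent (proj₁ e) (proj₂ e) ≡ true
      remaining≡  : length processed + r ≡ 2 * ∣E∣

  open Progress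

  module _ {i : ℕ} {σ : Vec Vertex i} {label : Labelling} (v : Vertex) where

    label′ : Labelling
    label′ = appendToNeighbours (suc i) (σ ∷ʳᵛ v) v label

    label-adjacent : ∀ {w} → w ∉ᵛ σ ∷ʳᵛ v → adjacent v w ≡ true → label′ w ≡ label w ++ [ int⁺ (suc i) ]
    label-adjacent {w} w∉ vw rewrite vw | dec-false (w ∈? (σ ∷ʳᵛ v)) w∉ = refl

    label-not-adjacent : ∀ {w} → adjacent v w ≡ false → label′ w ≡ label w
    label-not-adjacent vw rewrite vw = refl

    -- Words have to match labels only for `w ≢ v`, because at the first visit the source lies in
    -- the root class with word `[]` while its label is ∞. The degree of `v` is taken from the
    -- budget `r`.
    visit-progress : ∀ {U₀ Lab Stamp₀ s f g o k D E j S} {P : List (Vertex × Vertex)} {r} → i < n →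
      Run i σ label → v ∉ᵛ σ → (∀ w → w ∉ᵛ σ → ¬ (label v <ˡᵉˣ label w)) →
      (∀ q → o (suc (toℕ q)) ≡ vertexValue (lookup σ q)) →
      Unique P → (∀ {e} → e ∈ P → proj₁ e ∈ᵛ σ × adjacent (proj₁ e) (proj₂ e) ≡ true) →
      length P + r ≡ 2 * ∣E∣ →
      (∀ {w} → U₀ w → w ∉ᵛ σ) → (∀ {w} → w ∉ᵛ σ → U₀ w) →
      (∀ {w S} → w ≢ v → Lab w S → Labels i label w S) → (∀ {j y} → Stamp₀ j y → Stamps σ j y) →
      Registers i s → registers s chosenReg ≡ vertexValue v →
      Memory (heap s) f g o k (D ++ (j , vert v S) ∷ E) → Path i before (D ++ (j , vert v S) ∷ E) after →
      Consistent f g U₀ Lab Stamp₀ (D ++ (j , vert v S) ∷ E) → (∀ {w} → ¬ U₀ w → entry g w ≡ nil) →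
      ∃[ r′ ] Terminating visit s (12 + (length (neighbours v)) * 42 + potential (D ++ E) * 8) (Progress (suc i) r′) ×
              r ≡ length (neighbours v) + r′
    visit-progress {U₀} {Lab} {Stamp₀} {o = o} {P = P} {r} i<n runσ v∉ maximal out uniq adj rem U₀⇒ ⇒U₀ labs stamps R v≡ M ds C off
      = r′ , (let t , s′ , φ , run , le , T = terminates in t , s′ , φ , run , le , progress T) , r≡
      where
      ws : List Vertex
      ws = neighbours v
      P′ : List (Vertex × Vertex)
      P′ = map (v ,_) ws ++ P
      adjacent⁺ : ∀ {w} → w ∈ ws → adjacent v w ≡ true
      adjacent⁺ {w} = Equivalence.to (complete v w)
      adjacent⁻ : ∀ {w} → w ∉ ws → adjacent v w ≡ false
      adjacent⁻ {w} w∉ = ¬-not (w∉ ∘ Equivalence.from (complete v w))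
      -- The edges leaving `v` are new, since all earlier ones leave vertices of `σ` and `v` is not
      -- among them.
      uniq′ : Unique P′
      uniq′ = Unique.++⁺ (Unique.map⁺ (cong proj₂) (unique v)) uniq disjoint
        where
        disjoint : ∀ {e} → ¬ (e ∈ map (v ,_) ws × e ∈ P)
        disjoint (e∈ , e∈P) with _ , _ , refl ← ∈-map⁻ (v ,_) e∈ = v∉ (proj₁ (adj e∈P))
      adj′ : ∀ {e} → e ∈ P′ → proj₁ e ∈ᵛ (σ ∷ʳᵛ v) × adjacent (proj₁ e) (proj₂ e) ≡ true
      adj′ e∈ with ∈-++⁻ (map (v ,_) ws) e∈
      ... | inj₂ e∈P = let u∈ , uw = adj e∈P in ∈-∷ʳ⁺ˡ u∈ , uw
      ... | inj₁ e∈v with _ , w∈ , refl ← ∈-map⁻ (v ,_) e∈v = ∈-∷ʳ⁺ʳ σ , adjacent⁺ w∈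
      bounded : ∃[ r′ ] length P′ + r′ ≡ 2 * ∣E∣
      bounded = _ , m+[n∸m]≡n (directed-bound uniq′ (proj₂ ∘ adj′))
      r′ : ℕ
      r′ = proj₁ bounded
      r≡ : r ≡ length ws + r′
      r≡ = +-cancelˡ-≡ (length P) _ _ (begin
        length P + r                       ≡⟨ trans rem (sym (proj₂ bounded)) ⟩
        length P′ + r′                     ≡⟨ cong (λ l → l + r′) (trans (length-++ (map (v ,_) ws)) (cong (λ l → l + length P) (length-map (v ,_) ws))) ⟩
        length ws + length P + r′          ≡⟨ cong (λ l → l + r′) (+-comm (length ws) (length P)) ⟩
        length P + length ws + r′          ≡⟨ +-assoc (length P) (length ws) r′ ⟩
        length P + (length ws + r′)        ∎)
        where open ≡-Reasoning
      -- During the visit its own marks must be distinguishable from older ones; `settled` merges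
      -- the two kinds afterwards.
      Stamp : ℕ → Vertex → Set
      Stamp j y = (y ≡ v × j ≡ suc i) ⊎ Stamps σ j y
      terminates : Terminating visit _ _ (Tracking (_∉ᵛ (σ ∷ʳᵛ v)) (Labels (suc i) label′) Stamp (suc i) _ (suc i))
      terminates = visit-terminates {Lab₀ = Labels i label}
        (λ w → ¬? (w ∈? (σ ∷ʳᵛ v)))
        (λ U₀w w≢v w∈ → not-in (U₀⇒ U₀w) w≢v (∈-∷ʳ⁻ σ w∈)) (λ w∉ → ⇒U₀ (w∉ ∘ ∈-∷ʳ⁺ˡ)) (λ v∉ → v∉ (∈-∷ʳ⁺ʳ σ))
        (inj₁ (refl , refl))
        (λ { (inj₁ new) → inj₁ new ; (inj₂ (y∈ , j≤i)) → inj₂ ((λ { refl → v∉ y∈ }) , s≤s j≤i) })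
        (inj₂ ∘ stamps)
        (λ w∉ → labs λ { refl → w∉ (∈-∷ʳ⁺ʳ σ) })
        (s≤s ∘ proj₂)
        (λ w∉ w∈ (eq , _) → trans (label-adjacent w∉ (adjacent⁺ w∈)) (cong (λ x → x ++ [ int⁺ (suc i) ]) eq) , ≤-refl)
        (λ _ w∉ (eq , le) → trans (label-not-adjacent (adjacent⁻ w∉)) eq , m≤n⇒m≤1+n le)
        i<n R v≡ M ds C off
        where
        not-in : ∀ {w} → w ∉ᵛ σ → w ≢ v → ¬ (w ∈ᵛ σ ⊎ w ≡ v)
        not-in w∉ w≢v (inj₁ w∈)  = w∉ w∈
        not-in w∉ w≢v (inj₂ w≡v) = w≢v w≡v
      progress : ∀ {s φ} → Tracking (_∉ᵛ (σ ∷ʳᵛ v)) (Labels (suc i) label′) Stamp (suc i)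
                               (o [ suc i ↦ vertexValue v ]) (suc i) s φ → Progress (suc i) r′ s φ
      progress T = record
        { run = choose v runσ v∉ maximal
        ; tracking = record
            { Tracking T hiding (consistent)
            ; consistent = consistent-map (λ w∉ → w∉) (λ w∉ → w∉) (λ _ lab → lab) settled (Tracking.consistent T) }
        ; output≡ = lookup-∷ʳ σ v (λ j y → (o [ suc i ↦ vertexValue v ]) (suc j) ≡ vertexValue y)
            (λ q → trans (↦-other o (<⇒≢ (s≤s (toℕ<n q)))) (out q)) (↦-same o (suc i))
        ; unique-processed = uniq′
        ; adjacent-processed = adj′
        ; remaining≡ = proj₂ bounded
        }
        where
        settled : ∀ {j y} → Stamp j y → Stamps (σ ∷ʳᵛ v) j y
        settled (inj₁ (refl , refl)) = ∈-∷ʳ⁺ʳ σ , ≤-refl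
        settled (inj₂ (y∈ , j≤i))    = ∈-∷ʳ⁺ˡ y∈ , m≤n⇒m≤1+n j≤i

  FoundIn : ∀ {i r s φ} → Progress i r s φ → State → ℕ → Set
  FoundIn {i} Q = Found (Tracking.positions (tracking Q)) (Tracking.classes (tracking Q)) (output Q)
                    (_∉ᵛ order Q) (Labels i (labelling Q)) (Stamps (order Q)) i i

  find-next : ∀ {i r s φ} → i < n → (Q : Progress i r s φ) → Terminating find s (3 + φ * 8) (FoundIn Q)
  find-next {i} {s = s} i<n Q with _ , w∉ ← missing i<n (order Q) =
    subst (λ p → Terminating find s (3 + p * 8) (FoundIn Q)) (Tracking.potential≡ T)
      (find-terminates (Tracking.registersOk T) (Tracking.memory T) (Tracking.consistent T) (Tracking.path T)
        (λ (y∈ , _) → Tracking.classes-nil T (λ y∉ → y∉ y∈)) w∉)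
    where
    T : Tracking (_∉ᵛ order Q) (Labels i (labelling Q)) (Stamps (order Q)) i (output Q) i s _
    T = tracking Q

  visit-found : ∀ {i r s φ s₁ φ₁} → i < n → (Q : Progress i r s φ) → FoundIn Q s₁ φ₁ →
    ∃[ d ] ∃[ r′ ] Terminating visit s₁ (12 + d * 42 + φ₁ * 8) (Progress (suc i) r′) × r ≡ d + r′
  visit-found {s₁ = s₁} i<n Q F =
    let r′ , terminates , r≡ = visit-progress (Found.vertex F) i<n (run Q) v∉ highest
          (output≡ Q) (unique-processed Q) (adjacent-processed Q) (remaining≡ Q)
          (λ w∉ → w∉) (λ w∉ → w∉) (λ _ lab → lab) (λ st → st)
          (Found.registersOk F) (Found.chosen≡ F) (Found.memory F) (Found.path F) (Found.consistent F)
          (Tracking.classes-nil (tracking Q))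
    in _ , r′ ,
       subst (λ p → Terminating visit s₁ (12 + length (neighbours (Found.vertex F)) * 42 + p * 8) (Progress _ r′))
         (Found.potential≡ F) terminates ,
       r≡
    where
    v∉ : Found.vertex F ∉ᵛ order Q
    v∉ = let v∉ , _ = itemOk (Found.consistent F) (∈-insert (Found.left F)) in v∉
    v≡ : labelling Q (Found.vertex F) ≡ word (Found.label F)
    v≡ = let _ , (v≡ , _) , _ = itemOk (Found.consistent F) (∈-insert (Found.left F)) in v≡
    highest : ∀ w → w ∉ᵛ order Q → ¬ (labelling Q (Found.vertex F) <ˡᵉˣ labelling Q w)
    highest w w∉ v<w =
      let _ , S , w∈ = covers (Found.consistent F) w∉
          _ , (w≡ , _) , _ = itemOk (Found.consistent F) w∈
      in ≤ˡᵉˣ⇒≯ˡᵉˣ (Found.maximal F w∈)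
           (subst (λ x → x <ˡᵉˣ word S) v≡
             (subst (λ x → labelling Q (Found.vertex F) <ˡᵉˣ x) w≡ v<w))

  -- Sixteen per round: one step for the test, three for the search and twelve for the visit, beyond
  -- what potential and degrees pay.
  loop-terminates : ∀ m {i r s φ} → i + m ≡ n → Progress i r s φ →
    Terminating (while (counterReg lessThan sizeReg) (find ⨾ visit)) s (1 + m * 16 + r * 42 + φ * 8)
      (λ s φ → ∃[ r ] Progress n r s φ)
  loop-terminates zero {i} {r} {s} {φ} i+0≡n Q with refl ← trans (sym (+-identityʳ i)) i+0≡n =
    1 , s , φ , whileNotLess⇓ (counter≡ R) (size≡ R) (<-irrefl refl) ,
    +-monoˡ-≤ (φ * 8) (m≤m+n 1 (r * 42)) , r , Q
    where
    R : Registers i s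
    R = Tracking.registersOk (tracking Q)
  loop-terminates (suc m) {i} {r} {s} {φ} i+m≡n Q
    with i<n ← subst (λ j → suc i ≤ j) i+m≡n (m<m+n i (s≤s z≤n))
    with t₁ , s₁ , φ₁ , run₁ , le₁ , F ← find-next i<n Q
    with d , r′ , (t₂ , s₂ , φ₂ , run₂ , le₂ , Q₂) , r≡ ← visit-found i<n Q F
    with t₃ , s₃ , φ₃ , run₃ , le₃ , done ← loop-terminates m (trans (sym (+-suc i m)) i+m≡n) Q₂ =
    _ , s₃ , φ₃ , whileLess⇓ (counter≡ R) (size≡ R) i<n (seq⇓ run₁ run₂) run₃ ,
    enough t₁ t₂ t₃ φ₁ φ₂ φ₃ d r′ r≡ le₁ le₂ le₃ , done
    where
    R : Registers i s
    R = Tracking.registersOk (tracking Q)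
    enough : ∀ t₁ t₂ t₃ φ₁ φ₂ φ₃ d r′ → r ≡ d + r′ → t₁ + φ₁ * 8 ≤ 3 + φ * 8 → t₂ + φ₂ * 8 ≤ 12 + d * 42 + φ₁ * 8 →
             t₃ + φ₃ * 8 ≤ 1 + m * 16 + r′ * 42 + φ₂ * 8 →
             suc (t₁ + t₂ + t₃) + φ₃ * 8 ≤ 1 + suc m * 16 + r * 42 + φ * 8
    enough t₁ t₂ t₃ φ₁ φ₂ φ₃ d r′ refl le₁ le₂ le₃ = begin
      suc (t₁ + t₂ + t₃) + φ₃ * 8                                  ≡⟨ +-assoc (suc (t₁ + t₂)) t₃ _ ⟩
      suc (t₁ + t₂) + (t₃ + φ₃ * 8)                                ≤⟨ +-monoʳ-≤ (suc (t₁ + t₂)) le₃ ⟩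
      suc (t₁ + t₂) + (1 + m * 16 + r′ * 42 + φ₂ * 8)              ≡⟨ lemma₁ t₁ t₂ m r′ φ₂ ⟩
      2 + t₁ + m * 16 + r′ * 42 + (t₂ + φ₂ * 8)                    ≤⟨ +-monoʳ-≤ (2 + t₁ + m * 16 + r′ * 42) le₂ ⟩
      2 + t₁ + m * 16 + r′ * 42 + (12 + d * 42 + φ₁ * 8)           ≡⟨ lemma₂ t₁ m r′ d φ₁ ⟩
      14 + m * 16 + (d + r′) * 42 + (t₁ + φ₁ * 8)                  ≤⟨ +-monoʳ-≤ (14 + m * 16 + (d + r′) * 42) le₁ ⟩
      14 + m * 16 + (d + r′) * 42 + (3 + φ * 8)                    ≡⟨ lemma₃ m (d + r′) φ ⟩
      1 + suc m * 16 + (d + r′) * 42 + φ * 8                       ∎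
      where
      open ≤-Reasoning
      lemma₁ : ∀ t₁ t₂ m r p → suc (t₁ + t₂) + (1 + m * 16 + r * 42 + p * 8) ≡ 2 + t₁ + m * 16 + r * 42 + (t₂ + p * 8)
      lemma₁ = solve-∀
      lemma₂ : ∀ t m r d p → 2 + t + m * 16 + r * 42 + (12 + d * 42 + p * 8) ≡ 14 + m * 16 + (d + r) * 42 + (t + p * 8)
      lemma₂ = solve-∀
      lemma₃ : ∀ m r p → 14 + m * 16 + r * 42 + (3 + p * 8) ≡ 1 + suc m * 16 + r * 42 + p * 8
      lemma₃ = solve-∀

  initial-labels : ∀ {w S} → w ≢ source → S ≡ [] → Labels 0 initialLabels w S
  initial-labels {w} w≢s refl rewrite dec-false (w Fin.≟ source) w≢s = refl , z≤n

  source-maximal : ∀ w → ¬ (initialLabels source <ˡᵉˣ initialLabels w)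
  source-maximal w s<w rewrite dec-true (source Fin.≟ source) refl with w Fin.≟ source | s<w
  ... | yes _ | Lex.this ()
  ... | yes _ | Lex.next _ (Lex.base ())
  ... | no  _ | ()

  nonempty : 0 < n
  nonempty = ≤-trans (s≤s z≤n) (toℕ<n source)

  first-visit : ∀ {s φ} → Tracking (Filled n) Root None 0 (λ _ → nil) 0 s φ →
    registers s chosenReg ≡ vertexValue source →
    ∃[ d ] ∃[ r ] Terminating visit s (12 + d * 42 + φ * 8) (Progress 1 r) × 2 * ∣E∣ ≡ d + r
  first-visit {s} {φ} record { items = D ; registersOk = R ; memory = M ; path = ds ; consistent = C
                             ; classes-nil = off ; potential≡ = P≡ } v≡
    with j , S , v∈ ← covers C (toℕ<n source)
    with D , E , refl ← ∈-∃++ v∈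
    with r , (t , s′ , φ′ , run , le , Q) , r≡ ←
      visit-progress source {P = []} {r = 2 * ∣E∣} nonempty start (λ ()) (λ w _ → source-maximal w)
        (λ ()) [] (λ ()) refl (λ _ ()) (λ _ → toℕ<n _) initial-labels (λ ()) R v≡ M ds C off =
    _ , r , (t , s′ , φ′ , run , ≤-trans le (+-monoʳ-≤ _ (*-monoˡ-≤ 8 smaller)) , Q) , r≡
    where
    -- The weight of the source is simply given up, as no search has to be paid for.
    smaller : potential (D ++ E) ≤ φ
    smaller = subst (λ p → potential (D ++ E) ≤ p)
      (trans (sym (potential-↭ (shift (j , vert source S) D E))) P≡) (m≤n+m _ _)

  Result : Set
  Result = ∃[ t ] ∃[ s ] ∃[ σ ] ((B ⊢ program , input A ⇓[ t ] s) × t ≤ (n + ∣E∣) * 100 ×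
                                 Outputs s σ × IsLexUPOrdering G σ)

  program-terminates : Result
  program-terminates = from-setup setup-terminates
    where
    from-setup : Terminating setup (input A) (44 + n * 19)
                   (λ s φ → Tracking (Filled n) Root None 0 (λ _ → nil) 0 s φ ×
                            registers s chosenReg ≡ vertexValue source) → Result
    from-setup (t₀ , s₀ , φ₀ , run₀ , le₀ , T , v≡) = from-visit (first-visit T v≡)
      where
      from-visit : ∃[ d ] ∃[ r ] Terminating visit s₀ (12 + d * 42 + φ₀ * 8) (Progress 1 r) × 2 * ∣E∣ ≡ d + r → Result
      from-visit (d , r , (t₁ , s₁ , φ₁ , run₁ , le₁ , Q₁) , r≡) =
        from-loop (loop-terminates (n ∸ 1) (m+[n∸m]≡n nonempty) Q₁)
        where
        from-loop : Terminating (while (counterReg lessThan sizeReg) (find ⨾ visit)) s₁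
                      (1 + (n ∸ 1) * 16 + r * 42 + φ₁ * 8) (λ s φ → ∃[ r ] Progress n r s φ) → Result
        from-loop (t₂ , s₂ , φ₂ , run₂ , le₂ , _ , Q₂) =
          _ , _ , order Q₂ , seq⇓ run₀ (seq⇓ run₁ (seq⇓ run₂ assign⇓)) ,
          total-time nonempty t₀ t₁ t₂ φ₀ φ₁ φ₂ d r r≡ le₀ le₁ le₂ ,
          (outputAt , output Q₂ , Search.output≡ (Tracking.registersOk (tracking Q₂)) ,
           outputMem (Tracking.memory (tracking Q₂)) , output≡ Q₂) ,
          labelling Q₂ , run Q₂

open Graph using (∣V∣; ∣E∣)

mainTheorem3 : ∃[ program ] ∃[ c ] ((G : Graph) (A : AdjacencyLists G) →
    ∃[ t ] ∃[ s ] ∃[ σ ]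
    ( (integerBound G ⊢ program , input A ⇓[ t ] s)
    × (t ≤ c * (∣V∣ G + ∣E∣ G))
    × Outputs s σ
    × IsLexUPOrdering G σ))
mainTheorem3 = program , 100 , λ G A →
  let t , s , σ , run , t≤ , outputs , lexUP = Correctness.program-terminates G A
  in t , s , σ , run , ≤-trans t≤ (≤-reflexive (*-comm (∣V∣ G + ∣E∣ G) 100)) , outputs , lexUP
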